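{- Let $n$ and $\gamma$ be positive integers and put $\mu=\frac{(n-1)\gamma}{2}$. If there exists a large set with multiplicity LS$(3,4,n;\mu)$ and a perpendicular array PA$_{\gamma}(2,n,n)$, then there exists a large set with multiplicity LS$(3,4,4n;\mu)$.
   Context: A Steiner system S$(t,k,n)$ is a pair $(Q,B)$ where $Q$ is an $n$-set and $B$ is a collection of $k$-subsets (blocks) of $Q$ such that every $t$-subset of $Q$ is contained in exactly one block. An S$(3,4,n)$ is a Steiner quadruple system SQS$(n)$. A large set with multiplicity $\mu$, LS$(t,k,n;\mu)$, is a family (the same system may occur more than once) of Steiner systems S$(t,k,n)$ on a common $n$-set $Q$ such that every $k$-subset of $Q$ is a block of exactly $\mu$ of the systems (it then consists of $\mu\binom{n-t}{k-t}$ systems). A perpendicular array PA$_\lambda(k,\ell,n)$ is a $\lambda\binom{n}{k}\times \ell$ matrix with entries from an $n$-set such that each row has $\ell$ distinct entries and, in the submatrix formed by any $k$ columns, each $k$-subset of the $n$-set occurs (as the set of entries of a row) exactly $\lambda$ times.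
   Formalization: A large set LS(t,k,n;μ) is required to have k ≤ n, so n ≥ 4 here; without this the empty family is an LS(3,4,3;1) and PA_1(2,3,3) exists, but LS(3,4,12;1) does not, since there is no SQS(12). -}

module Defs where

open import Data.Bool.Properties using () renaming (_≟_ to _≟ᵇ_)
open import Data.Fin using (Fin)
open import Data.Fin.Properties using (any?) renaming (_≟_ to _≟ᶠ_)
open import Data.Fin.Subset using (Subset; ∣_∣; _⊆_)
open import Data.Fin.Subset.Properties using (_∈?_)
open import Data.List using (List; length; filter; allFin)
open import Data.Nat using (ℕ; _*_; _≤_)
open import Data.Nat.Combinatorics using (_C_)
open import Data.Product using (∃!; _×_)
open import Data.Vec using (tabulate)
open import Data.Vec.Properties using (≡-dec)
open import Function.Definitions using (Injective)
open import Level using (0ℓ)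
open import Relation.Binary.Definitions using (DecidableEquality)
open import Relation.Binary.PropositionalEquality using (_≡_)
open import Relation.Nullary using (does)
open import Relation.Nullary.Decidable using (_×-dec_)
open import Relation.Unary using (Pred; Decidable)

infix 4 _≟ˢ_

_≟ˢ_ : ∀ {n} → DecidableEquality (Subset n)
_≟ˢ_ = ≡-dec _≟ᵇ_

image : ∀ {m n} → (Fin m → Fin n) → Subset m → Subset n
image f X = tabulate λ y → does (any? λ x → (x ∈? X) ×-dec (f x ≟ᶠ y))

-- The point set is Fin n.  The collection of blocks is a set (not a multiset),
-- given by a decidable predicate.
record SteinerSystem (t k n : ℕ) : Set₁ where
  field
    Block      : Pred (Subset n) 0ℓ
    block?     : Decidable Block
    block-size : ∀ {S} → Block S → ∣ S ∣ ≡ k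
    covers     : ∀ T → ∣ T ∣ ≡ t → ∃! _≡_ λ S → Block S × T ⊆ S

open SteinerSystem public

-- The number of systems in a family, counted with repetition, that have K as
-- a block.
multiplicity : ∀ {t k n} → List (SteinerSystem t k n) → Subset n → ℕ
multiplicity systems K = length (filter (λ 𝒮 → block? 𝒮 K) systems)

-- The order of the list is irrelevant; it represents a family with repetition.
-- k≤n is the usual standing convention on the parameters of a Steiner system.
-- When n < k there are no k-subsets, so without it every list of systems would
-- qualify: the empty list, in particular, would be an LS(3,4,3;μ) for every μ.
record LargeSet (t k n μ : ℕ) : Set₁ where
  field
    k≤n     : k ≤ n
    systems : List (SteinerSystem t k n)
    uniform : ∀ K → ∣ K ∣ ≡ k → multiplicity systems K ≡ μ

-- PerpendicularArray γ k ℓ n is PA_γ(k,ℓ,n).  A choice of k columns is a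
-- k-subset of Fin ℓ.
record PerpendicularArray (γ k ℓ n : ℕ) : Set where
  field
    entry    : Fin (γ * (n C k)) → Fin ℓ → Fin n
    distinct : ∀ r → Injective _≡_ _≡_ (entry r)
    balanced : ∀ (J : Subset ℓ) (S : Subset n) → ∣ J ∣ ≡ k → ∣ S ∣ ≡ k →
               length (filter (λ r → image (entry r) J ≟ˢ S) (allFin (γ * (n C k)))) ≡ γ

{-# OPTIONS --safe #-}
-- A quadruple system is encoded by the operation op that completes a triple to a
-- block, extended by op x x y = y.  A large set is then a list of operations
-- taking each value w ∉ {x, y, z} at distinct x, y, z equally often.
--
-- The 4n points form four groups of n, and a 4-subset is of type 4, 31, 22, 211 or
-- 1111 according to how it is distributed over the groups.  There are two sorts of
-- systems.
-- A: for each system S of the given large set, a copy of S on every group; blocks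
--    of type 22 joining pairs of two groups whose labels in a one-factorization of
--    K_n are matched by a reflection x ↦ u - x; blocks of type 1111 with entries
--    summing to t, where t ≠ 0, 1, 2.
-- B: for each row π of the array and each of the three splittings of the groups
--    into two halves, the two groups of each half are joined along π, by blocks
--    {a, b, π a, π b} and blocks of type 31; the two halves are joined by blocks of
--    type 211 and by blocks of type 1111 with entry sum 0, 1 or 2, depending on the
--    splitting.
-- A 4-subset of type 4 lies only in blocks of A; types 31 and 211 occur only in B,
-- for exactly one splitting, μ times since every entry occurs μ times in a column
-- of the array; for type 22 the array yields γ systems of B, and there are μ - γ
-- systems of A for every u; for type 1111 each entry sum occurs μ times.
module Submission where

open import Defs
open import Algebra.Bundles using (AbelianGroup)
import Algebra.Properties.AbelianGroup as AbelianGroupProperties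
import Algebra.Properties.CommutativeMonoid.Sum as CommutativeMonoidSum
open import Data.Bool using (Bool; true; false; not; if_then_else_; _xor_)
open import Data.Bool.Properties using (not-involutive; not-¬; ¬-not) renaming (_≟_ to _≟ᵇ_)
open import Data.Empty using (⊥-elim)
open import Data.Fin using (Fin; zero; suc; toℕ; fromℕ<; punchIn; punchOut; combine; remQuot)
open import Data.Fin.Patterns using (0F; 1F; 2F; 3F)
open import Data.Fin.Properties
  using (any?; toℕ-injective; toℕ-fromℕ<; toℕ<n; punchInᵢ≢i; punchOut-injective;
         injective⇒≤; remQuot-combine; combine-remQuot)
  renaming (_≟_ to _≟ᶠ_; suc-injective to sucᶠ-injective)
open import Data.Fin.Subset using (Subset; ∣_∣; _⊆_; _∪_; ⁅_⁆; ⊥; inside; outside)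
  renaming (_∈_ to _∈ˢ_; _∉_ to _∉ˢ_)
open import Data.Fin.Subset.Properties
  using (∪-identityˡ; ∪-assoc; ∪-comm; x∈p∪q⁻; x∈p∪q⁺; x∈⁅x⁆; x∈⁅y⁆⇒x≡y; ∉⊥; ∣⊥∣≡0;
         ⊆-antisym; nonempty?; Empty-unique; _∈?_)
open import Data.List using (List; []; _∷_; _++_; map; zip; length; filter; foldr; allFin)
open import Data.List.Membership.Propositional using (_∈_)
open import Data.List.Properties
  using (filter-≐; filter-++; filter-none; length-++; length-map; length-tabulate; map-tabulate)
open import Data.List.Relation.Unary.All using ([]; _∷_; universal)
import Data.List.Relation.Unary.All as All
open import Data.List.Relation.Unary.AllPairs using ([]; _∷_)
open import Data.List.Relation.Unary.Any using (here; there)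
open import Data.List.Relation.Unary.Unique.Propositional using (Unique)
open import Data.Nat using (ℕ; zero; suc; _+_; _*_; _∸_; _≤_; z≤n; s≤s)
open import Data.Nat.Combinatorics using (_C_; nC1≡n; nCk+nC[k+1]≡[n+1]C[k+1])
open import Data.Nat.DivMod using (_%_; m%n<n; m<n⇒m%n≡m; n%n≡0; %-distribˡ-+; m%n%n≡m%n)
open import Data.Nat.Properties
open import Data.Nat.Tactic.RingSolver using (solve-∀)
open import Data.Product using (_×_; _,_; proj₁; proj₂; ∃; ∃!; ∃-syntax; swap)
open import Data.Product.Properties using (≡-dec)
open import Data.Sum as Sum using (_⊎_; inj₁; inj₂; [_,_]′)
open import Data.Vec using (_∷_; here; there)
open import Data.Vec.Properties using (lookup∘tabulate; lookup⇒[]=; []=⇒lookup)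
open import Function using (_∘_; _⇔_; mk⇔; Equivalence; id)
open import Function.Definitions using (Injective)
open import Level using (Level; 0ℓ)
open import Relation.Binary.Definitions using (DecidableEquality)
open import Relation.Binary.PropositionalEquality
open import Relation.Nullary using (¬_; Dec; yes; no; does)
open import Relation.Nullary.Decidable
  using (_×-dec_; _⊎-dec_; ¬?; does-⇔; dec-true; dec-false)
open import Relation.Unary using (Pred; Decidable)
open CommutativeMonoidSum +-0-commutativeMonoid using (sum; sum-remove; sum-cong-≗; ∑-distrib-+)

-- The cyclic group of order m + 1.

module _ (m : ℕ) where

  private
    N = suc m

    residue : ℕ → Fin N
    residue k = fromℕ< (m%n<n k N)

    toℕ-residue : ∀ k → toℕ (residue k) ≡ k % N
    toℕ-residue k = toℕ-fromℕ< (m%n<n k N)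

    %-absorbˡ : ∀ k l → (k % N + l) % N ≡ (k + l) % N
    %-absorbˡ k l = begin
      (k % N + l) % N          ≡⟨ %-distribˡ-+ (k % N) l N ⟩
      (k % N % N + l % N) % N  ≡⟨ cong (λ z → (z + l % N) % N) (m%n%n≡m%n k N) ⟩
      (k % N + l % N) % N      ≡⟨ %-distribˡ-+ k l N ⟨
      (k + l) % N              ∎
      where open ≡-Reasoning

    abstract
      add : Fin N → Fin N → Fin N
      add a b = residue (toℕ a + toℕ b)

      neg : Fin N → Fin N
      neg a = residue (N ∸ toℕ a)

      add-comm : ∀ a b → add a b ≡ add b a
      add-comm a b = cong residue (+-comm (toℕ a) (toℕ b))

      toℕ-add-add : ∀ a b c → toℕ (add (add a b) c) ≡ (toℕ a + toℕ b + toℕ c) % N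
      toℕ-add-add a b c = begin
        toℕ (add (add a b) c)                 ≡⟨ toℕ-residue (toℕ (add a b) + toℕ c) ⟩
        (toℕ (add a b) + toℕ c) % N           ≡⟨ cong (λ z → (z + toℕ c) % N) (toℕ-residue (toℕ a + toℕ b)) ⟩
        ((toℕ a + toℕ b) % N + toℕ c) % N     ≡⟨ %-absorbˡ (toℕ a + toℕ b) (toℕ c) ⟩
        (toℕ a + toℕ b + toℕ c) % N           ∎
        where open ≡-Reasoning

      add-assoc : ∀ a b c → add (add a b) c ≡ add a (add b c)
      add-assoc a b c = toℕ-injective (begin
        toℕ (add (add a b) c)        ≡⟨ toℕ-add-add a b c ⟩
        (toℕ a + toℕ b + toℕ c) % N  ≡⟨ cong (_% N) (trans (+-assoc (toℕ a) _ _) (+-comm (toℕ a) _)) ⟩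
        (toℕ b + toℕ c + toℕ a) % N  ≡⟨ toℕ-add-add b c a ⟨
        toℕ (add (add b c) a)        ≡⟨ cong toℕ (add-comm (add b c) a) ⟩
        toℕ (add a (add b c))        ∎)
        where open ≡-Reasoning

      add-identityˡ : ∀ a → add zero a ≡ a
      add-identityˡ a = toℕ-injective
        (trans (toℕ-residue (toℕ a)) (m<n⇒m%n≡m (toℕ<n a)))

      add-inverseˡ : ∀ a → add (neg a) a ≡ zero
      add-inverseˡ a = toℕ-injective (begin
        toℕ (add (neg a) a)              ≡⟨ toℕ-residue (toℕ (neg a) + toℕ a) ⟩
        (toℕ (neg a) + toℕ a) % N        ≡⟨ cong (λ z → (z + toℕ a) % N) (toℕ-residue (N ∸ toℕ a)) ⟩
        ((N ∸ toℕ a) % N + toℕ a) % N    ≡⟨ %-absorbˡ (N ∸ toℕ a) (toℕ a) ⟩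
        (N ∸ toℕ a + toℕ a) % N          ≡⟨ cong (_% N) (m∸n+n≡m (<⇒≤ (toℕ<n a))) ⟩
        N % N                            ≡⟨ n%n≡0 N ⟩
        0                                ∎)
        where open ≡-Reasoning

  ℤ/suc : AbelianGroup 0ℓ 0ℓ
  ℤ/suc = record
    { Carrier = Fin N ; _≈_ = _≡_ ; _∙_ = add ; ε = zero ; _⁻¹ = neg
    ; isAbelianGroup = record
      { isGroup = record
        { isMonoid = record
          { isSemigroup = record
            { isMagma = record { isEquivalence = isEquivalence ; ∙-cong = cong₂ add }
            ; assoc = add-assoc }
          ; identity = add-identityˡ , λ a → trans (add-comm a zero) (add-identityˡ a) }
        ; inverse = add-inverseˡ , λ a → trans (add-comm a (neg a)) (add-inverseˡ a)
        ; ⁻¹-cong = cong neg }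
      ; comm = add-comm } }

-- Quadruple systems as ternary operations

-- A Steiner skein. The two swaps and `invol` make the relation `op x y z ≡ w` invariant under all
-- permutations of its four arguments.
record Skein (P : Set) : Set where
  field
    op     : P → P → P → P
    swap₁₂ : ∀ x y z → op x y z ≡ op y x z
    swap₂₃ : ∀ x y z → op x y z ≡ op x z y
    absorb : ∀ x y → op x x y ≡ y
    invol  : ∀ x y z → op x y (op x y z) ≡ z

  swap₁₃ : ∀ x y z → op x y z ≡ op z y x
  swap₁₃ x y z = trans (swap₁₂ x y z) (trans (swap₂₃ y x z) (swap₁₂ y z x))

  absorb₁₃ : ∀ x y → op x y x ≡ y
  absorb₁₃ x y = trans (swap₂₃ x y x) (absorb x y)

  absorb₂₃ : ∀ x y → op x y y ≡ x
  absorb₂₃ x y = trans (swap₁₃ x y y) (absorb y x)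

  op≡-swap₃₄ : ∀ {x y z w} → op x y z ≡ w → op x y w ≡ z
  op≡-swap₃₄ {x} {y} {z} refl = invol x y z

open Skein

Distinct₃ : {A : Set} → A → A → A → Set
Distinct₃ x y z = x ≢ y × x ≢ z × y ≢ z

module _ {A : Set} where

  distinct-swap₁₂ : {x y z : A} → Distinct₃ x y z → Distinct₃ y x z
  distinct-swap₁₂ (p , q , r) = p ∘ sym , r , q

  distinct-swap₂₃ : {x y z : A} → Distinct₃ x y z → Distinct₃ x z y
  distinct-swap₂₃ (p , q , r) = q , p , r ∘ sym

  -- If the completion were `x`, then `invol` would give `z` = `op S x y x` = `y`; the case of `y`
  -- is similar.
  distinct-op : (S : Skein A) → ∀ {x y z} → Distinct₃ x y z → Distinct₃ x y (op S x y z)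
  distinct-op S {x} {y} {z} (x≢y , x≢z , y≢z) =
    x≢y ,
    (λ e → y≢z (trans (sym (absorb₁₃ S x y)) (op≡-swap₃₄ S (sym e)))) ,
    (λ e → x≢z (trans (sym (absorb₂₃ S x y)) (op≡-swap₃₄ S (sym e))))

-- Serves twice: to permute the four groups of points, and to pass from structured points to
-- `Fin (4 * n)`.
conjugate : {P Q : Set} (f : P → Q) (g : Q → P) →
            (∀ x → g (f x) ≡ x) → (∀ y → f (g y) ≡ y) → Skein Q → Skein P
conjugate f g gf fg S = record
  { op     = λ x y z → g (op S (f x) (f y) (f z))
  ; swap₁₂ = λ x y z → cong g (swap₁₂ S (f x) (f y) (f z))
  ; swap₂₃ = λ x y z → cong g (swap₂₃ S (f x) (f y) (f z))
  ; absorb = λ x y → trans (cong g (absorb S (f x) (f y))) (gf y)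
  ; invol  = λ x y z → trans
      (cong g (trans (cong (op S (f x) (f y)) (fg _)) (invol S (f x) (f y) (f z)))) (gf z)
  }

-- An operation on two copies of X: same ε acts on three points of the copy ε, and
-- mixed ε a b c on a and b in the copy ε and c in the other one.
module TwoSided {X : Set}
  (same mixed : Bool → X → X → X → Bool × X)
  where

  op₂ : Bool × X → Bool × X → Bool × X → Bool × X
  op₂ (false , a) (false , b) (false , c) = same false a b c
  op₂ (false , a) (false , b) (true  , c) = mixed false a b c
  op₂ (false , a) (true  , b) (false , c) = mixed false a c b
  op₂ (true  , a) (false , b) (false , c) = mixed false b c a
  op₂ (true  , a) (true  , b) (true  , c) = same true a b c
  op₂ (true  , a) (true  , b) (false , c) = mixed true a b c
  op₂ (true  , a) (false , b) (true  , c) = mixed true a c b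
  op₂ (false , a) (true  , b) (true  , c) = mixed true b c a

  op₂-same : ∀ ε a b c → op₂ (ε , a) (ε , b) (ε , c) ≡ same ε a b c
  op₂-same false a b c = refl
  op₂-same true  a b c = refl

  op₂-mixed₃ : ∀ ε a b c → op₂ (ε , a) (ε , b) (not ε , c) ≡ mixed ε a b c
  op₂-mixed₃ false a b c = refl
  op₂-mixed₃ true  a b c = refl

  op₂-mixed₂ : ∀ ε a b c → op₂ (ε , a) (not ε , b) (ε , c) ≡ mixed ε a c b
  op₂-mixed₂ false a b c = refl
  op₂-mixed₂ true  a b c = refl

  op₂-mixed₁ : ∀ ε a b c → op₂ (ε , a) (not ε , b) (not ε , c) ≡ mixed (not ε) b c a
  op₂-mixed₁ false a b c = refl
  op₂-mixed₁ true  a b c = refl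

  module _
    (same-swap₁₂  : ∀ ε a b c → same ε a b c ≡ same ε b a c)
    (same-swap₂₃  : ∀ ε a b c → same ε a b c ≡ same ε a c b)
    (mixed-swap₁₂ : ∀ ε a b c → mixed ε a b c ≡ mixed ε b a c)
    (same-absorb  : ∀ ε a b → same ε a a b ≡ (ε , b))
    (mixed-absorb : ∀ ε a b → mixed ε a a b ≡ (not ε , b))
    (same-invol   : ∀ ε a b c → op₂ (ε , a) (ε , b) (same ε a b c) ≡ (ε , c))
    (mixed₃-invol : ∀ ε a b c → op₂ (ε , a) (ε , b) (mixed ε a b c) ≡ (not ε , c))
    (mixed₂-invol : ∀ ε a b c → op₂ (ε , a) (not ε , b) (mixed ε a c b) ≡ (ε , c))
    where

    private
      swap₁₂₂ : ∀ x y z → op₂ x y z ≡ op₂ y x z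
      swap₁₂₂ (false , a) (false , b) (false , c) = same-swap₁₂ false a b c
      swap₁₂₂ (false , a) (false , b) (true  , c) = mixed-swap₁₂ false a b c
      swap₁₂₂ (false , a) (true  , b) (false , c) = refl
      swap₁₂₂ (true  , a) (false , b) (false , c) = refl
      swap₁₂₂ (true  , a) (true  , b) (true  , c) = same-swap₁₂ true a b c
      swap₁₂₂ (true  , a) (true  , b) (false , c) = mixed-swap₁₂ true a b c
      swap₁₂₂ (true  , a) (false , b) (true  , c) = refl
      swap₁₂₂ (false , a) (true  , b) (true  , c) = refl

      swap₂₃₂ : ∀ x y z → op₂ x y z ≡ op₂ x z y
      swap₂₃₂ (false , a) (false , b) (false , c) = same-swap₂₃ false a b c
      swap₂₃₂ (false , a) (false , b) (true  , c) = refl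
      swap₂₃₂ (false , a) (true  , b) (false , c) = refl
      swap₂₃₂ (true  , a) (false , b) (false , c) = mixed-swap₁₂ false b c a
      swap₂₃₂ (true  , a) (true  , b) (true  , c) = same-swap₂₃ true a b c
      swap₂₃₂ (true  , a) (true  , b) (false , c) = refl
      swap₂₃₂ (true  , a) (false , b) (true  , c) = refl
      swap₂₃₂ (false , a) (true  , b) (true  , c) = mixed-swap₁₂ true b c a

      absorb₂ : ∀ x y → op₂ x x y ≡ y
      absorb₂ (false , a) (false , b) = same-absorb false a b
      absorb₂ (false , a) (true  , b) = mixed-absorb false a b
      absorb₂ (true  , a) (true  , b) = same-absorb true a b
      absorb₂ (true  , a) (false , b) = mixed-absorb true a b

      invol₂ : ∀ x y z → op₂ x y (op₂ x y z) ≡ z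
      invol₂ (false , a) (false , b) (false , c) = same-invol false a b c
      invol₂ (false , a) (false , b) (true  , c) = mixed₃-invol false a b c
      invol₂ (false , a) (true  , b) (false , c) = mixed₂-invol false a b c
      -- A lone first point becomes a lone second point after swapping the first two arguments.
      invol₂ (true  , a) (false , b) (false , c) =
        trans (swap₁₂₂ (true , a) (false , b) (mixed false b c a)) (mixed₂-invol false b a c)
      invol₂ (true  , a) (true  , b) (true  , c) = same-invol true a b c
      invol₂ (true  , a) (true  , b) (false , c) = mixed₃-invol true a b c
      invol₂ (true  , a) (false , b) (true  , c) = mixed₂-invol true a b c
      invol₂ (false , a) (true  , b) (true  , c) =
        trans (swap₁₂₂ (false , a) (true , b) (mixed true b c a)) (mixed₂-invol true b a c)

    twoSided : Skein (Bool × X)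
    twoSided = record
      { op = op₂ ; swap₁₂ = swap₁₂₂ ; swap₂₃ = swap₂₃₂ ; absorb = absorb₂ ; invol = invol₂ }

-- One-factorizations, and doubling by matched labels.

-- A one-factorization of the complete graph on `A`: `lab x y` is the factor containing the edge,
-- `act k x` the partner of `x` in the factor `k`. The label `one` is reserved for the loops, so
-- that degenerate pairs need no separate treatment.
record Factorization (A Λ : Set) : Set where
  field
    act      : Λ → A → A
    lab      : A → A → Λ
    one      : Λ
    act-lab  : ∀ x y → act (lab x y) x ≡ y
    lab-act  : ∀ k x → lab x (act k x) ≡ k
    lab-comm : ∀ x y → lab x y ≡ lab y x
    lab-diag : ∀ x → lab x x ≡ one

  act-invol : ∀ k x → act k (act k x) ≡ x
  act-invol k x = trans
    (cong (λ l → act l (act k x)) (trans (sym (lab-act k x)) (lab-comm x (act k x))))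
    (act-lab (act k x) x)

  act-one : ∀ x → act one x ≡ x
  act-one x = trans (cong (λ l → act l x) (sym (lab-diag x))) (act-lab x x)

  lab-injective : ∀ {x y} → lab x y ≡ one → x ≡ y
  lab-injective {x} {y} e = trans (sym (act-one x)) (trans (cong (λ l → act l x) (sym e)) (act-lab x y))

-- `to h` takes the label of a pair in the copy `h` to the label of the pairs in the other copy that
-- complete it to a block. By `to-one` degenerate pairs meet only degenerate pairs, as `absorb`
-- demands.
record Matching (Λ : Set) (one : Λ) : Set where
  field
    to     : Bool → Λ → Λ
    to-inv : ∀ h k → to (not h) (to h k) ≡ k
    to-one : ∀ h → to h one ≡ one

-- Two copies of A; a pair in one copy and a pair in the other form a block when
-- their labels are matched.
module _ {A Λ : Set} (S : Skein A) (F : Factorization A Λ)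
         (M : Matching Λ (Factorization.one F)) where

  open Factorization F
  open Matching M

  private
    same mixed : Bool → A → A → A → Bool × A
    same  h a b c = h , op S a b c
    mixed h a b c = not h , act (to h (lab a b)) c

    open TwoSided same mixed

    mixed₂-invol : ∀ h a b c → op₂ (h , a) (not h , b) (mixed h a c b) ≡ (h , c)
    mixed₂-invol h a b c = begin
      op₂ (h , a) (not h , b) (not h , act k b)                 ≡⟨ op₂-mixed₁ h a b (act k b) ⟩
      not (not h) , act (to (not h) (lab b (act k b))) a        ≡⟨ cong₂ _,_ (not-involutive h) lemma ⟩
      h , c                                                     ∎
      where
      open ≡-Reasoning
      k = to h (lab a c)
      -- The pair formed by `b` and `act k b` has label `k`, which is matched back with the label of
      -- `a` and `c`.
      lemma = begin
        act (to (not h) (lab b (act k b))) a  ≡⟨ cong (λ l → act (to (not h) l) a) (lab-act k b) ⟩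
        act (to (not h) k) a                  ≡⟨ cong (λ l → act l a) (to-inv h (lab a c)) ⟩
        act (lab a c) a                       ≡⟨ act-lab a c ⟩
        c                                     ∎

  doubling : Skein (Bool × A)
  doubling = twoSided
    (λ h a b c → cong (h ,_) (swap₁₂ S a b c))
    (λ h a b c → cong (h ,_) (swap₂₃ S a b c))
    (λ h a b c → cong (λ l → not h , act (to h l) c) (lab-comm a b))
    (λ h a b → cong (h ,_) (absorb S a b))
    (λ h a b → cong (not h ,_) (trans
      (cong (λ l → act l b) (trans (cong (to h) (lab-diag a)) (to-one h))) (act-one b)))
    (λ h a b c → trans (op₂-same h a b _) (cong (h ,_) (invol S a b c)))
    (λ h a b c → trans (op₂-mixed₃ h a b _) (cong (not h ,_) (act-invol _ c)))
    mixed₂-invol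

  doubling-same : ∀ h a b c → op doubling (h , a) (h , b) (h , c) ≡ (h , op S a b c)
  doubling-same = op₂-same

-- Joining two copies along a permutation.

distinct? : {A : Set} → DecidableEquality A → (a b c : A) → Dec (Distinct₃ a b c)
distinct? _≟_ a b c = ¬? (a ≟ b) ×-dec (¬? (a ≟ c) ×-dec ¬? (b ≟ c))

-- On a triple with a repetition `op` cancels two equal entries and returns the remaining one, a
-- rule that commutes with every map.
op-equivariant-degenerate : {A : Set} → DecidableEquality A → (S : Skein A) → (f : A → A) → ∀ {a b c} →
  ¬ Distinct₃ a b c → op S (f a) (f b) (f c) ≡ f (op S a b c)
op-equivariant-degenerate _≟_ S f {a} {b} {c} ¬d with a ≟ b | a ≟ c | b ≟ c
... | yes refl | _ | _ = trans (absorb S _ _) (cong f (sym (absorb S _ _)))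
... | no _ | yes refl | _ = trans (absorb₁₃ S _ _) (cong f (sym (absorb₁₃ S _ _)))
... | no _ | no _ | yes refl = trans (absorb₂₃ S _ _) (cong f (sym (absorb₂₃ S _ _)))
... | no p | no q | no r = ⊥-elim (¬d (p , q , r))

-- Two copies of A identified by π: the blocks are {a, b, π a, π b} and, for each
-- block of S in either copy, the four sets obtained by moving one of its points
-- to the other copy.
module _ {A : Set} (_≟_ : DecidableEquality A) (S : Skein A)
         (π : Bool → A → A) (π-inv : ∀ ε a → π (not ε) (π ε a) ≡ a) where

  private
    lift : Bool → Bool → A → Bool × A
    lift ε stay a = if stay then (ε , a) else (not ε , π ε a)

    same mixed : Bool → A → A → A → Bool × A
    same  ε a b c = lift ε (not (does (distinct? _≟_ a b c))) (op S a b c)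
    mixed ε a b c = lift ε (does (distinct? _≟_ a b (π (not ε) c))) (op S a b (π (not ε) c))

    open TwoSided same mixed

    π-invʳ : ∀ ε a → π ε (π (not ε) a) ≡ a
    π-invʳ ε a = trans (cong (λ e → π e (π (not ε) a)) (sym (not-involutive ε))) (π-inv (not ε) a)

    distinct-π⁻¹ : ∀ ε {a b c} → Distinct₃ (π ε a) (π ε b) (π ε c) → Distinct₃ a b c
    distinct-π⁻¹ ε (p , q , r) = p ∘ cong (π ε) , q ∘ cong (π ε) , r ∘ cong (π ε)

    distinct-op⁻¹ : ∀ {a b c} → Distinct₃ a b (op S a b c) → Distinct₃ a b c
    distinct-op⁻¹ {a} {b} {c} d = subst (Distinct₃ a b) (invol S a b c) (distinct-op S d)

    same-distinct : ∀ ε {a b c} → Distinct₃ a b c → same ε a b c ≡ (not ε , π ε (op S a b c))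
    same-distinct ε {a} {b} {c} d rewrite dec-true (distinct? _≟_ a b c) d = refl

    same-degenerate : ∀ ε {a b c} → ¬ Distinct₃ a b c → same ε a b c ≡ (ε , op S a b c)
    same-degenerate ε {a} {b} {c} d rewrite dec-false (distinct? _≟_ a b c) d = refl

    mixed-distinct : ∀ ε {a b c} → Distinct₃ a b c → mixed ε a b (π ε c) ≡ (ε , op S a b c)
    mixed-distinct ε {a} {b} {c} d rewrite π-inv ε c | dec-true (distinct? _≟_ a b c) d = refl

    mixed-degenerate : ∀ ε {a b c} → ¬ Distinct₃ a b c →
                       mixed ε a b (π ε c) ≡ (not ε , π ε (op S a b c))
    mixed-degenerate ε {a} {b} {c} d rewrite π-inv ε c | dec-false (distinct? _≟_ a b c) d = refl

    same-swap₁₂ : ∀ ε a b c → same ε a b c ≡ same ε b a c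
    same-swap₁₂ ε a b c = cong₂ (λ δ → lift ε (not δ))
      (does-⇔ (mk⇔ distinct-swap₁₂ distinct-swap₁₂) (distinct? _≟_ a b c) (distinct? _≟_ b a c))
      (swap₁₂ S a b c)

    same-swap₂₃ : ∀ ε a b c → same ε a b c ≡ same ε a c b
    same-swap₂₃ ε a b c = cong₂ (λ δ → lift ε (not δ))
      (does-⇔ (mk⇔ distinct-swap₂₃ distinct-swap₂₃) (distinct? _≟_ a b c) (distinct? _≟_ a c b))
      (swap₂₃ S a b c)

    mixed-swap₁₂ : ∀ ε a b c → mixed ε a b c ≡ mixed ε b a c
    mixed-swap₁₂ ε a b c = cong₂ (lift ε)
      (does-⇔ (mk⇔ distinct-swap₁₂ distinct-swap₁₂) (distinct? _≟_ a b c′) (distinct? _≟_ b a c′))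
      (swap₁₂ S a b c′)
      where c′ = π (not ε) c

    same-absorb : ∀ ε a b → same ε a a b ≡ (ε , b)
    same-absorb ε a b = trans (same-degenerate ε λ d → proj₁ d refl) (cong (ε ,_) (absorb S a b))

    mixed-absorb : ∀ ε a b → mixed ε a a (π ε b) ≡ (not ε , π ε b)
    mixed-absorb ε a b = trans (mixed-degenerate ε λ d → proj₁ d refl)
      (cong (λ z → not ε , π ε z) (absorb S a b))

    same-invol : ∀ ε a b c → op₂ (ε , a) (ε , b) (same ε a b c) ≡ (ε , c)
    same-invol ε a b c with distinct? _≟_ a b c
    ... | yes d = trans (cong (op₂ (ε , a) (ε , b)) (same-distinct ε d))
                 (trans (op₂-mixed₃ ε a b _)
                 (trans (mixed-distinct ε (distinct-op S d)) (cong (ε ,_) (invol S a b c))))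
    ... | no ¬d = trans (cong (op₂ (ε , a) (ε , b)) (same-degenerate ε ¬d))
                 (trans (op₂-same ε a b _)
                 (trans (same-degenerate ε (¬d ∘ distinct-op⁻¹)) (cong (ε ,_) (invol S a b c))))

    mixed₃-invol : ∀ ε a b c → op₂ (ε , a) (ε , b) (mixed ε a b (π ε c)) ≡ (not ε , π ε c)
    mixed₃-invol ε a b c with distinct? _≟_ a b c
    ... | yes d = trans (cong (op₂ (ε , a) (ε , b)) (mixed-distinct ε d))
                 (trans (op₂-same ε a b _)
                 (trans (same-distinct ε (distinct-op S d))
                        (cong (λ z → not ε , π ε z) (invol S a b c))))
    ... | no ¬d = trans (cong (op₂ (ε , a) (ε , b)) (mixed-degenerate ε ¬d))
                 (trans (op₂-mixed₃ ε a b _)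
                 (trans (mixed-degenerate ε (¬d ∘ distinct-op⁻¹))
                        (cong (λ z → not ε , π ε z) (invol S a b c))))

    mixed₂-invol : ∀ ε a b c → op₂ (ε , a) (not ε , π ε b) (mixed ε a c (π ε b)) ≡ (ε , c)
    mixed₂-invol ε a b c with distinct? _≟_ a c b
    ... | yes d = begin
      op₂ (ε , a) (not ε , π ε b) (mixed ε a c (π ε b))  ≡⟨ cong (op₂ (ε , a) (not ε , π ε b)) (mixed-distinct ε d) ⟩
      op₂ (ε , a) (not ε , π ε b) (ε , op S a c b)       ≡⟨ op₂-mixed₂ ε a (π ε b) _ ⟩
      mixed ε a (op S a c b) (π ε b)                     ≡⟨ cong (λ z → mixed ε a z (π ε b)) (swap₂₃ S a c b) ⟩
      mixed ε a (op S a b c) (π ε b)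
        ≡⟨ mixed-distinct ε (distinct-swap₂₃ (distinct-op S (distinct-swap₂₃ d))) ⟩
      ε , op S a (op S a b c) b
        ≡⟨ cong (ε ,_) (trans (swap₂₃ S a _ b) (invol S a b c)) ⟩
      ε , c                                              ∎
      where open ≡-Reasoning
    ... | no ¬d = begin
      op₂ (ε , a) (not ε , π ε b) (mixed ε a c (π ε b))  ≡⟨ cong (op₂ (ε , a) (not ε , π ε b)) (mixed-degenerate ε ¬d) ⟩
      op₂ (ε , a) (not ε , π ε b) (not ε , π ε (op S a c b)) ≡⟨ op₂-mixed₁ ε a (π ε b) _ ⟩
      mixed (not ε) (π ε b) (π ε (op S a c b)) a
        ≡⟨ cong₂ (λ u v → mixed (not ε) (π ε b) (π ε u) v) (swap₂₃ S a c b) (sym (π-inv ε a)) ⟩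
      mixed (not ε) (π ε b) (π ε e) (π (not ε) (π ε a))
        ≡⟨ mixed-degenerate (not ε) (¬d-rot ∘ distinct-π⁻¹ ε) ⟩
      -- `π ε` may fail to preserve the blocks of `S`, but on a degenerate triple it commutes with
      -- `op S`.
      not (not ε) , π (not ε) (op S (π ε b) (π ε e) (π ε a))
        ≡⟨ cong₂ (λ u v → u , π (not ε) v) (not-involutive ε) (op-equivariant-degenerate _≟_ S (π ε) ¬d-rot) ⟩
      ε , π (not ε) (π ε (op S b e a))                   ≡⟨ cong (ε ,_) (π-inv ε _) ⟩
      ε , op S b e a                                     ≡⟨ cong (ε ,_) (trans (swap₁₃ S b e a) (trans (swap₂₃ S a e b) (invol S a b c))) ⟩
      ε , c                                              ∎
      where
      open ≡-Reasoning
      e = op S a b c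
      ¬d-rot : ¬ Distinct₃ b e a
      ¬d-rot d = ¬d (distinct-swap₂₃ (distinct-op⁻¹ (distinct-swap₁₂ (distinct-swap₂₃ d))))

  twist : Skein (Bool × A)
  twist = twoSided same-swap₁₂ same-swap₂₃ mixed-swap₁₂ same-absorb
    -- The laws were proved for points of the other copy written as images under `π ε`; by `π-invʳ`
    -- every point is such an image.
    (λ ε a b → subst (λ z → mixed ε a a z ≡ (not ε , z)) (π-invʳ ε b)
                 (mixed-absorb ε a (π (not ε) b)))
    same-invol
    (λ ε a b c → subst (λ z → op₂ (ε , a) (ε , b) (mixed ε a b z) ≡ (not ε , z)) (π-invʳ ε c)
                   (mixed₃-invol ε a b (π (not ε) c)))
    (λ ε a b c → subst (λ z → op₂ (ε , a) (not ε , z) (mixed ε a c z) ≡ (ε , c)) (π-invʳ ε b)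
                   (mixed₂-invol ε a (π (not ε) b) c))

  twist-same : ∀ ε {a b c} → Distinct₃ a b c →
               op twist (ε , a) (ε , b) (ε , c) ≡ (not ε , π ε (op S a b c))
  twist-same ε {a} {b} {c} d = trans (op₂-same ε a b c) (same-distinct ε d)

  twist-mixed-distinct : ∀ ε {a b c} → Distinct₃ a b c →
               op twist (ε , a) (ε , b) (not ε , π ε c) ≡ (ε , op S a b c)
  twist-mixed-distinct ε {a} {b} {c} d = trans (op₂-mixed₃ ε a b _) (mixed-distinct ε d)

  twist-mixed-degenerate : ∀ ε {a b c} → ¬ Distinct₃ a b c →
               op twist (ε , a) (ε , b) (not ε , π ε c) ≡ (not ε , π ε (op S a b c))
  twist-mixed-degenerate ε {a} {b} {c} d = trans (op₂-mixed₃ ε a b _) (mixed-degenerate ε d)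

-- Labels and matchings built from differences in the cyclic group.

module Cyclic (m : ℕ) where

  open AbelianGroup (ℤ/suc m) public
    using () renaming (_∙_ to _⊕_; _-_ to _⊖_; comm to ⊕-comm; assoc to ⊕-assoc; identityˡ to ⊕-identityˡ)
  open AbelianGroupProperties (ℤ/suc m)

  ⊖-⊕ : ∀ x y → (x ⊖ y) ⊕ y ≡ x
  ⊖-⊕ x y = //-rightDividesˡ y x

  ⊕-⊖ : ∀ x y → (x ⊕ y) ⊖ y ≡ x
  ⊕-⊖ x y = //-rightDividesʳ y x

  ⊖≡⇒ : ∀ {x y z} → x ⊖ y ≡ z → x ≡ z ⊕ y
  ⊖≡⇒ {x} {y} refl = sym (⊖-⊕ x y)

  ⊖≡⇐ : ∀ {x y z} → x ≡ z ⊕ y → x ⊖ y ≡ z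
  ⊖≡⇐ {y = y} {z} refl = ⊕-⊖ z y

  ⊖-self : ∀ x → x ⊖ x ≡ zero
  ⊖-self x = ⊖≡⇐ (sym (⊕-identityˡ x))

  ⊖≡zero : ∀ {x y} → x ⊖ y ≡ zero → x ≡ y
  ⊖≡zero {x} {y} e = trans (⊖≡⇒ e) (⊕-identityˡ y)

  ⊖-invol : ∀ x y → x ⊖ (x ⊖ y) ≡ y
  ⊖-invol x y = ⊖≡⇐ (trans (sym (⊖-⊕ x y)) (⊕-comm (x ⊖ y) y))

-- The Steiner loop of the triple system derived at the point zero.
loop : ∀ {m} → Skein (Fin (suc m)) → Factorization (Fin (suc m)) (Fin (suc m))
loop S = record
  { act      = op S zero
  ; lab      = op S zero
  ; one      = zero
  ; act-lab  = λ x y → trans (swap₂₃ S zero _ x) (invol S zero x y)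
  ; lab-act  = λ k x → trans (cong (op S zero x) (swap₂₃ S zero k x)) (invol S zero x k)
  ; lab-comm = swap₂₃ S zero
  ; lab-diag = absorb₂₃ S zero
  }

-- Pairs inside a copy keep their label k, now written (false , k); a pair across
-- the two copies is labelled (true , v) by the sum v of its entries.
module _ {m : ℕ} (F : Factorization (Fin (suc m)) (Fin (suc m))) where

  open Factorization F
  open Cyclic m

  crossed : Factorization (Bool × Fin (suc m)) (Bool × Fin (suc m))
  crossed = record
    { act = act₂ ; lab = lab₂ ; one = false , one
    ; act-lab = act-lab₂ ; lab-act = lab-act₂ ; lab-comm = lab-comm₂ ; lab-diag = lab-diag₂ }
    where
    act₂ : Bool × Fin (suc m) → Bool × Fin (suc m) → Bool × Fin (suc m)
    act₂ (false , k) (ε , a) = ε , act k a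
    act₂ (true  , v) (ε , a) = not ε , v ⊖ a

    lab₂ : Bool × Fin (suc m) → Bool × Fin (suc m) → Bool × Fin (suc m)
    lab₂ (false , a) (false , b) = false , lab a b
    lab₂ (true  , a) (true  , b) = false , lab a b
    lab₂ (false , a) (true  , b) = true , a ⊕ b
    lab₂ (true  , a) (false , b) = true , a ⊕ b

    cancel : ∀ a b → (a ⊕ b) ⊖ a ≡ b
    cancel a b = trans (cong (_⊖ a) (⊕-comm a b)) (⊕-⊖ b a)

    restore : ∀ a v → a ⊕ (v ⊖ a) ≡ v
    restore a v = trans (⊕-comm a (v ⊖ a)) (⊖-⊕ v a)

    act-lab₂ : ∀ x y → act₂ (lab₂ x y) x ≡ y
    act-lab₂ (false , a) (false , b) = cong (false ,_) (act-lab a b)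
    act-lab₂ (true  , a) (true  , b) = cong (true ,_) (act-lab a b)
    act-lab₂ (false , a) (true  , b) = cong (true ,_) (cancel a b)
    act-lab₂ (true  , a) (false , b) = cong (false ,_) (cancel a b)

    lab-act₂ : ∀ k x → lab₂ x (act₂ k x) ≡ k
    lab-act₂ (false , k) (false , a) = cong (false ,_) (lab-act k a)
    lab-act₂ (false , k) (true  , a) = cong (false ,_) (lab-act k a)
    lab-act₂ (true  , v) (false , a) = cong (true ,_) (restore a v)
    lab-act₂ (true  , v) (true  , a) = cong (true ,_) (restore a v)

    lab-comm₂ : ∀ x y → lab₂ x y ≡ lab₂ y x
    lab-comm₂ (false , a) (false , b) = cong (false ,_) (lab-comm a b)
    lab-comm₂ (true  , a) (true  , b) = cong (false ,_) (lab-comm a b)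
    lab-comm₂ (false , a) (true  , b) = cong (true ,_) (⊕-comm a b)
    lab-comm₂ (true  , a) (false , b) = cong (true ,_) (⊕-comm a b)

    lab-diag₂ : ∀ x → lab₂ x x ≡ (false , one)
    lab-diag₂ (false , a) = cong (false ,_) (lab-diag a)
    lab-diag₂ (true  , a) = cong (false ,_) (lab-diag a)

-- The nonzero labels form a cyclic group of their own, of order one less than the number of
-- entries, so that for nonzero labels `x` and `y` exactly one `u` reflects `x` to `y`. Label zero
-- belongs to degenerate pairs and stays fixed.
reflect : ∀ {p} → Fin (suc p) → Fin (suc (suc p)) → Fin (suc (suc p))
reflect u zero    = zero
reflect {p} u (suc x) = suc (u ⊖ x)
  where open Cyclic p

reflect-invol : ∀ {p} (u : Fin (suc p)) k → reflect u (reflect u k) ≡ k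
reflect-invol u zero    = refl
reflect-invol {p} u (suc x) = cong suc (⊖-invol u x)
  where open Cyclic p

reflection : ∀ {p} → Fin (suc p) → Matching (Fin (suc (suc p))) zero
reflection u = record
  { to = λ _ → reflect u ; to-inv = λ _ → reflect-invol u ; to-one = λ _ → refl }

-- Cross pairs with sum `v` are matched with cross pairs with sum `t ⊖ v`, which gives blocks of
-- type 1111 the entry sum `t`.
crossedReflection : ∀ {p} → Fin (suc p) → Fin (suc (suc p)) →
                    Matching (Bool × Fin (suc (suc p))) (false , zero)
crossedReflection {p} u t = record
  { to = λ _ → to ; to-inv = λ _ → to-invol ; to-one = λ _ → refl }
  where
  open Cyclic (suc p)
  to : Bool × Fin (suc (suc p)) → Bool × Fin (suc (suc p))
  to (false , k) = false , reflect u k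
  to (true  , v) = true , t ⊖ v
  to-invol : ∀ k → to (to k) ≡ k
  to-invol (false , k) = cong (false ,_) (reflect-invol u k)
  to-invol (true  , v) = cong (true ,_) (⊖-invol t v)

-- The cross labels s and s′ of the two halves are matched with each other; every
-- other cross label, at distance k from s or s′, is matched with the label k of
-- pairs inside a copy.
module _ {m : ℕ} where

  open Cyclic m

  private
    L = Bool × Fin (suc m)

  relabel : Fin (suc m) → Fin (suc m) → L
  relabel s zero    = true , s
  relabel s (suc k) = false , suc k

  exchange : Fin (suc m) → Fin (suc m) → L → L
  exchange s s′ (false , zero)  = false , zero
  exchange s s′ (false , suc k) = true , suc k ⊕ s′
  exchange s s′ (true  , v)     = relabel s′ (v ⊖ s)

  private
    exchange-inv : ∀ s s′ k → exchange s′ s (exchange s s′ k) ≡ k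
    exchange-inv s s′ (false , zero) = refl
    exchange-inv s s′ (false , suc k) rewrite ⊕-⊖ (suc k) s′ = refl
    exchange-inv s s′ (true , v) with v ⊖ s in eq
    ... | zero rewrite ⊖-self s′ = cong (true ,_) (sym (⊖≡zero eq))
    ... | suc k = cong (true ,_) (sym (⊖≡⇒ eq))

  exchanging : Fin (suc m) → Fin (suc m) → Matching L (false , zero)
  exchanging s s′ = record { to = to ; to-inv = to-inv ; to-one = to-one }
    where
    to : Bool → L → L
    to false = exchange s s′
    to true  = exchange s′ s
    to-inv : ∀ h k → to (not h) (to h k) ≡ k
    to-inv false = exchange-inv s s′
    to-inv true  = exchange-inv s′ s
    to-one : ∀ h → to h (false , zero) ≡ (false , zero)
    to-one false = refl
    to-one true  = refl

-- The two sorts of systems on four groups, and their blocks by type.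

Group : Set
Group = Bool × Bool

_≟ᵍ_ : DecidableEquality Group
_≟ᵍ_ = ≡-dec _≟ᵇ_ _≟ᵇ_

pt : {F : Set} → Group → F → Bool × (Bool × F)
pt (h , ε) a = h , (ε , a)

pt-injective : ∀ {i} {F : Set} {a b : F} → pt i a ≡ pt i b → a ≡ b
pt-injective refl = refl

pt-group : {F : Set} → ∀ {i k} {a b : F} → pt i a ≡ pt k b → i ≡ k
pt-group refl = refl

module Quadruple {p : ℕ} (S₀ : Skein (Fin (suc (suc p)))) where

  private
    F = Fin (suc (suc p))

  Point : Set
  Point = Bool × (Bool × F)

  open Cyclic (suc p)
  open Factorization (loop S₀) using (act; lab; act-lab; lab-act; lab-injective)

  -- The inner `doubling` joins the two groups of each half, the outer one joins the halves. All
  -- labels come from the fixed `S₀`, so that type 22 depends on `u` alone while `S` varies.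
  typeA : Skein F → F → Fin (suc p) → Skein Point
  typeA S t u = doubling (doubling S (loop S₀) (reflection u))
                         (crossed (loop S₀)) (crossedReflection u t)

  -- The exchanged cross sums of the two halves are `s` and `t ⊖ s`; they fix the entry sum `t` of
  -- type 1111 while `s` is free to vary.
  typeB : F → (π : Bool → F → F) → (∀ ε a → π (not ε) (π ε a) ≡ a) → F → Skein Point
  typeB t π π-inv s = doubling (twist _≟ᶠ_ S₀ π π-inv)
                               (crossed (loop S₀)) (exchanging s (t ⊖ s))

  module TypeA (S : Skein F) (t : F) (u : Fin (suc p)) where

    private
      A = typeA S t u

    type-4 : ∀ i a b c → op A (pt i a) (pt i b) (pt i c) ≡ pt i (op S a b c)
    type-4 (false , false) a b c = refl
    type-4 (false , true)  a b c = refl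
    type-4 (true  , false) a b c = refl
    type-4 (true  , true)  a b c = refl

    -- One rule holds within a half and across halves, because the outer matching acts on the labels
    -- of pairs inside a group by the same reflection.
    type-22 : ∀ i k a b c → i ≢ k →
           op A (pt i a) (pt i b) (pt k c) ≡ pt k (act (reflect u (lab a b)) c)
    type-22 (false , false) (false , false) a b c i≢k = ⊥-elim (i≢k refl)
    type-22 (false , false) (false , true)  a b c i≢k = refl
    type-22 (false , false) (true  , false) a b c i≢k = refl
    type-22 (false , false) (true  , true)  a b c i≢k = refl
    type-22 (false , true)  (false , false) a b c i≢k = refl
    type-22 (false , true)  (false , true)  a b c i≢k = ⊥-elim (i≢k refl)
    type-22 (false , true)  (true  , false) a b c i≢k = refl
    type-22 (false , true)  (true  , true)  a b c i≢k = refl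
    type-22 (true  , false) (false , false) a b c i≢k = refl
    type-22 (true  , false) (false , true)  a b c i≢k = refl
    type-22 (true  , false) (true  , false) a b c i≢k = ⊥-elim (i≢k refl)
    type-22 (true  , false) (true  , true)  a b c i≢k = refl
    type-22 (true  , true)  (false , false) a b c i≢k = refl
    type-22 (true  , true)  (false , true)  a b c i≢k = refl
    type-22 (true  , true)  (true  , false) a b c i≢k = refl
    type-22 (true  , true)  (true  , true)  a b c i≢k = ⊥-elim (i≢k refl)

    type-1111 : ∀ h ε ε′ a b c →
      op A (pt (h , ε) a) (pt (h , not ε) b) (pt (not h , ε′) c) ≡
      pt (not h , not ε′) ((t ⊖ (a ⊕ b)) ⊖ c)
    type-1111 false false ε′ a b c = refl
    type-1111 false true  ε′ a b c = refl
    type-1111 true  false ε′ a b c = refl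
    type-1111 true  true  ε′ a b c = refl

  module TypeB (t : F) (π : Bool → F → F) (π-inv : ∀ ε a → π (not ε) (π ε a) ≡ a) (s : F) where

    private
      B = typeB t π π-inv s

    s[_] : Bool → F
    s[ false ] = s
    s[ true ]  = t ⊖ s

    within-half : ∀ h x y z → op B (h , x) (h , y) (h , z) ≡ (h , op (twist _≟ᶠ_ S₀ π π-inv) x y z)
    within-half = doubling-same (twist _≟ᶠ_ S₀ π π-inv) (crossed (loop S₀)) (exchanging s (t ⊖ s))

    type-31 : ∀ h ε {a b c} → Distinct₃ a b c →
          op B (pt (h , ε) a) (pt (h , ε) b) (pt (h , ε) c) ≡ pt (h , not ε) (π ε (op S₀ a b c))
    type-31 h ε d = trans (within-half h _ _ _) (cong (h ,_) (twist-same _≟ᶠ_ S₀ π π-inv ε d))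

    -- Distinct entries have a nonzero label, and `exchange` turns it into the cross label at that
    -- distance from the chosen sum of the other half.
    type-211 : ∀ h ε ε′ {a b} c → a ≢ b →
      op B (pt (h , ε) a) (pt (h , ε) b) (pt (not h , ε′) c) ≡
      pt (not h , not ε′) ((lab a b ⊕ s[ not h ]) ⊖ c)
    type-211 h ε ε′ {a} {b} c a≢b with lab a b in eq | across h ε
      where
      across : ∀ h ε → op B (pt (h , ε) a) (pt (h , ε) b) (pt (not h , ε′) c) ≡
        (not h , Factorization.act (crossed (loop S₀))
                   (Matching.to (exchanging s (t ⊖ s)) h (false , lab a b)) (ε′ , c))
      across false false = refl
      across false true  = refl
      across true  false = refl
      across true  true  = refl
    ... | zero  | _ = ⊥-elim (a≢b (lab-injective eq))
    ... | suc k | e with h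
    ...   | false = e
    ...   | true  = e

    private
      -- Only a cross label moves a point to the other group of its half, and `relabel` produces one
      -- only at zero.
      relabel-across : ∀ r k ε c d →
        Factorization.act (crossed (loop S₀)) (relabel r k) (ε , c) ≡ (not ε , d) →
        k ≡ zero × r ⊖ c ≡ d
      relabel-across r zero    ε c d e = refl , cong proj₂ e
      relabel-across r (suc k) ε c d e = ⊥-elim (not-¬ refl (cong proj₁ e))

      type-1111-op : ∀ h ε ε′ a b c →
        op B (pt (h , ε) a) (pt (h , not ε) b) (pt (not h , ε′) c) ≡
        (not h , Factorization.act (crossed (loop S₀)) (relabel s[ not h ] ((a ⊕ b) ⊖ s[ h ])) (ε′ , c))
      type-1111-op false false ε′ a b c = refl
      type-1111-op false true  ε′ a b c = refl
      type-1111-op true  false ε′ a b c = refl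
      type-1111-op true  true  ε′ a b c = refl

    type-1111 : ∀ h ε ε′ a b c d →
      op B (pt (h , ε) a) (pt (h , not ε) b) (pt (not h , ε′) c) ≡ pt (not h , not ε′) d ⇔
      (a ⊕ b ≡ s[ h ] × c ⊕ d ≡ s[ not h ])
    type-1111 h ε ε′ a b c d = mk⇔ to from
      where
      to : _ ≡ _ → _
      to e with k≡0 , r ← relabel-across s[ not h ] ((a ⊕ b) ⊖ s[ h ]) ε′ c d
                           (cong proj₂ (trans (sym (type-1111-op h ε ε′ a b c)) e))
        = ⊖≡zero k≡0 , trans (⊕-comm c d) (sym (⊖≡⇒ r))
      from : _ → _ ≡ _
      from (e , e′) = trans (type-1111-op h ε ε′ a b c) (cong (not h ,_) lemma)
        where
        lemma : Factorization.act (crossed (loop S₀)) (relabel s[ not h ] ((a ⊕ b) ⊖ s[ h ])) (ε′ , c) ≡ (not ε′ , d)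
        lemma rewrite trans (cong (_⊖ s[ h ]) e) (⊖-self s[ h ]) =
          cong (not ε′ ,_) (⊖≡⇐ (trans (sym e′) (⊕-comm c d)))

    -- Pull `c` back along `π` to `c₀`. If `c₀` differs from `a` and `b`, the completion is the
    -- fourth point of a block of `S₀` and lies in the group of `a` and `b`; otherwise the block
    -- consists of `a`, `b` and their images.
    type-22 : ∀ h ε {a b c d} → a ≢ b → c ≢ d →
      op B (pt (h , ε) a) (pt (h , ε) b) (pt (h , not ε) c) ≡ pt (h , not ε) d ⇔
      ((π ε a ≡ c × π ε b ≡ d) ⊎ (π ε a ≡ d × π ε b ≡ c))
    type-22 h ε {a} {b} {c} {d} a≢b c≢d = mk⇔ to from
      where
      D = twist _≟ᶠ_ S₀ π π-inv

      c₀ = π (not ε) c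

      πc₀≡c : π ε c₀ ≡ c
      πc₀≡c = trans (cong (λ e → π e c₀) (sym (not-involutive ε))) (π-inv (not ε) c)

      value : ∀ {x} → op D (ε , a) (ε , b) (not ε , π ε c₀) ≡ x →
              op B (pt (h , ε) a) (pt (h , ε) b) (pt (h , not ε) c) ≡ (h , x)
      value e = trans (within-half h _ _ _)
        (cong (h ,_) (trans (cong (λ z → op D (ε , a) (ε , b) (not ε , z)) (sym πc₀≡c)) e))

      to : _ ≡ _ → _
      to e with a ≟ᶠ c₀ | b ≟ᶠ c₀
      ... | yes refl | _ = inj₁ (πc₀≡c , trans (cong (π ε) (sym (absorb₁₃ S₀ a b))) (cong (proj₂ ∘ proj₂)
              (trans (sym (value (twist-mixed-degenerate _≟ᶠ_ S₀ π π-inv ε λ z → proj₁ (proj₂ z) refl))) e)))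
      ... | no _ | yes refl = inj₂ (trans (cong (π ε) (sym (absorb₂₃ S₀ a b))) (cong (proj₂ ∘ proj₂)
              (trans (sym (value (twist-mixed-degenerate _≟ᶠ_ S₀ π π-inv ε λ z → proj₂ (proj₂ z) refl))) e)) , πc₀≡c)
      ... | no p | no q = ⊥-elim (not-¬ refl (cong (proj₁ ∘ proj₂)
              (trans (sym (value (twist-mixed-distinct _≟ᶠ_ S₀ π π-inv ε (a≢b , p , q)))) e)))

      from : _ → _ ≡ _
      from (inj₁ (refl , refl)) = trans (within-half h _ _ _) (cong (h ,_)
        (trans (twist-mixed-degenerate _≟ᶠ_ S₀ π π-inv ε λ z → proj₁ (proj₂ z) refl)
               (cong (λ z → not ε , π ε z) (absorb₁₃ S₀ a b))))
      from (inj₂ (refl , refl)) = trans (within-half h _ _ _) (cong (h ,_)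
        (trans (twist-mixed-degenerate _≟ᶠ_ S₀ π π-inv ε λ z → proj₂ (proj₂ z) refl)
               (cong (λ z → not ε , π ε z) (absorb₂₃ S₀ a b))))

-- Counting systems

private
  variable
    ℓ₁ ℓ₂ ℓ₃ ℓ₄ : Level

module _ {A : Set ℓ₁} {P : Pred A ℓ₃} (P? : Decidable P) where

  count : List A → ℕ
  count xs = length (filter P? xs)

  count-++ : ∀ xs ys → count (xs ++ ys) ≡ count xs + count ys
  count-++ xs ys = trans (cong length (filter-++ P? xs ys)) (length-++ (filter P? xs))

  count-none : (∀ x → ¬ P x) → ∀ xs → count xs ≡ 0
  count-none ¬P xs = cong length (filter-none P? (universal ¬P xs))

  count-map : {B : Set ℓ₂} (f : B → A) → ∀ xs → count (map f xs) ≡ length (filter (P? ∘ f) xs)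
  count-map f [] = refl
  count-map f (x ∷ xs) with does (P? (f x))
  ... | false = count-map f xs
  ... | true  = cong suc (count-map f xs)

count-cong : {A : Set ℓ₁} {P : Pred A ℓ₃} {Q : Pred A ℓ₄} (P? : Decidable P) (Q? : Decidable Q) →
             (∀ x → P x ⇔ Q x) → ∀ xs → count P? xs ≡ count Q? xs
count-cong P? Q? P⇔Q xs = cong length
  (filter-≐ P? Q? ((λ {x} → Equivalence.to (P⇔Q x)) , (λ {x} → Equivalence.from (P⇔Q x))) xs)

select : Bool → ℕ → ℕ
select δ k = if δ then k else 0

count-×-const : {A : Set ℓ₁} {P : Pred A ℓ₃} {Q : Set ℓ₄} (P? : Decidable P) (Q? : Dec Q) → ∀ xs →
                count (λ x → P? x ×-dec Q?) xs ≡ select (does Q?) (count P? xs)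
count-×-const P? (yes q) xs = count-cong _ P? (λ x → mk⇔ proj₁ (_, q)) xs
count-×-const P? (no ¬q) xs = count-none _ (λ x → ¬q ∘ proj₂) xs

module _ {A : Set ℓ₁} {B : Set ℓ₂} where

  count-zip₁ : {P : Pred A ℓ₃} (P? : Decidable P) → ∀ xs (ys : List B) → length xs ≡ length ys →
               count (P? ∘ proj₁) (zip xs ys) ≡ count P? xs
  count-zip₁ P? []       []       e = refl
  count-zip₁ P? (x ∷ xs) (y ∷ ys) e with does (P? x)
  ... | false = count-zip₁ P? xs ys (suc-injective e)
  ... | true  = cong suc (count-zip₁ P? xs ys (suc-injective e))

  count-zip₂ : {P : Pred B ℓ₃} (P? : Decidable P) → ∀ (xs : List A) ys → length xs ≡ length ys →
               count (P? ∘ proj₂) (zip xs ys) ≡ count P? ys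
  count-zip₂ P? []       []       e = refl
  count-zip₂ P? (x ∷ xs) (y ∷ ys) e with does (P? y)
  ... | false = count-zip₂ P? xs ys (suc-injective e)
  ... | true  = cong suc (count-zip₂ P? xs ys (suc-injective e))

  length-zip : ∀ (xs : List A) (ys : List B) → length xs ≡ length ys → length (zip xs ys) ≡ length xs
  length-zip []       []       e = refl
  length-zip (x ∷ xs) (y ∷ ys) e = cong suc (length-zip xs ys (suc-injective e))

-- The adjacent transpositions suffice, since they generate all permutations of four arguments.
record Symmetric₄ {P : Set} (R : P → P → P → P → Set) : Set where
  field
    sym₁₂ : ∀ {x y z w} → R x y z w → R y x z w
    sym₂₃ : ∀ {x y z w} → R x y z w → R x z y w
    sym₃₄ : ∀ {x y z w} → R x y z w → R x y w z

Distinct₄ : {A : Set} → A → A → A → A → Set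
Distinct₄ x y z w = Distinct₃ x y z × (x ≢ w × y ≢ w × z ≢ w)

distinct₄-symmetric : {A : Set} → Symmetric₄ (Distinct₄ {A})
distinct₄-symmetric = record
  { sym₁₂ = λ (d , (p , q , r)) → distinct-swap₁₂ d , (q , p , r)
  ; sym₂₃ = λ (d , (p , q , r)) → distinct-swap₂₃ d , (p , r , q)
  ; sym₃₄ = λ ((p , q , r) , (s , t , u)) → (p , s , t) , (q , r , u ∘ sym)
  }

implies-symmetric : {P : Set} {R R′ : P → P → P → P → Set} → Symmetric₄ R → Symmetric₄ R′ →
                    Symmetric₄ (λ x y z w → R x y z w → R′ x y z w)
implies-symmetric R R′ = record
  { sym₁₂ = λ f → Symmetric₄.sym₁₂ R′ ∘ f ∘ Symmetric₄.sym₁₂ R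
  ; sym₂₃ = λ f → Symmetric₄.sym₂₃ R′ ∘ f ∘ Symmetric₄.sym₂₃ R
  ; sym₃₄ = λ f → Symmetric₄.sym₃₄ R′ ∘ f ∘ Symmetric₄.sym₃₄ R
  }

module _ {P : Set} (_≟_ : DecidableEquality P) where

  -- For distinct points this counts the systems that have the four points as a block.
  number : List (Skein P) → P → P → P → P → ℕ
  number Ss x y z w = count (λ S → op S x y z ≟ w) Ss

  number-map : {I : Set} {Q : I → Set} (f : I → Skein P) (Q? : Decidable Q) → ∀ {x y z w} →
               (∀ i → op (f i) x y z ≡ w ⇔ Q i) → ∀ is → number (map f is) x y z w ≡ count Q? is
  number-map f Q? {x} {y} {z} {w} e is =
    trans (count-map (λ S → op S x y z ≟ w) f is) (count-cong _ Q? e is)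

  number-none : {I : Set} (f : I → Skein P) → ∀ {x y z w} →
                (∀ i → op (f i) x y z ≢ w) → ∀ is → number (map f is) x y z w ≡ 0
  number-none f {x} {y} {z} {w} e is =
    trans (count-map (λ S → op S x y z ≟ w) f is) (count-none _ e is)

  module _ (Ss : List (Skein P)) where

    number-swap₁₂ : ∀ x y z w → number Ss x y z w ≡ number Ss y x z w
    number-swap₁₂ x y z w = count-cong _ _
      (λ S → mk⇔ (trans (swap₁₂ S y x z)) (trans (swap₁₂ S x y z))) Ss

    number-swap₂₃ : ∀ x y z w → number Ss x y z w ≡ number Ss x z y w
    number-swap₂₃ x y z w = count-cong _ _
      (λ S → mk⇔ (trans (swap₂₃ S x z y)) (trans (swap₂₃ S x y z))) Ss

    number-swap₃₄ : ∀ x y z w → number Ss x y z w ≡ number Ss x y w z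
    number-swap₃₄ x y z w = count-cong _ _
      (λ S → mk⇔ (op≡-swap₃₄ S) (op≡-swap₃₄ S)) Ss

    -- Reduces the verification of a count to a single order of the four points.
    number-symmetric : (f : P → P → P → P → ℕ) →
      (∀ x y z w → f x y z w ≡ f y x z w) → (∀ x y z w → f x y z w ≡ f x z y w) →
      (∀ x y z w → f x y z w ≡ f x y w z) →
      Symmetric₄ (λ x y z w → number Ss x y z w ≡ f x y z w)
    number-symmetric f f₁₂ f₂₃ f₃₄ = record
      { sym₁₂ = λ {x} {y} {z} {w} e → trans (sym (number-swap₁₂ x y z w)) (trans e (f₁₂ x y z w))
      ; sym₂₃ = λ {x} {y} {z} {w} e → trans (sym (number-swap₂₃ x y z w)) (trans e (f₂₃ x y z w))
      ; sym₃₄ = λ {x} {y} {z} {w} e → trans (sym (number-swap₃₄ x y z w)) (trans e (f₃₄ x y z w))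
      }

other-half : ∀ {h ε k} → k ≢ (h , ε) → k ≢ (h , not ε) → proj₁ k ≡ not h
other-half {h} {ε} {h′ , ε′} p q = ¬-not lemma
  where
  lemma : h′ ≢ h
  lemma refl with ε′ ≟ᵇ ε
  ... | yes refl = p refl
  ... | no ≢ε = q (cong (h′ ,_) (¬-not ≢ε))

module _ {F : Set} {R : (x y z w : Bool × (Bool × F)) → Set} (R-sym : Symmetric₄ R) where

  open Symmetric₄ R-sym

  -- Bring two points of a common group to the front and compare the groups of the other two; if no
  -- two points share a group, the type is 1111.
  by-type :
    (∀ i a b c d → R (pt i a) (pt i b) (pt i c) (pt i d)) →
    (∀ i k a b c d → i ≢ k → R (pt i a) (pt i b) (pt i c) (pt k d)) →
    (∀ i k a b c d → i ≢ k → R (pt i a) (pt i b) (pt k c) (pt k d)) →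
    (∀ i k l a b c d → Distinct₃ i k l → R (pt i a) (pt i b) (pt k c) (pt l d)) →
    (∀ i j k l a b c d → Distinct₄ i j k l → R (pt i a) (pt j b) (pt k c) (pt l d)) →
    ∀ i j k l a b c d → R (pt i a) (pt j b) (pt k c) (pt l d)
  by-type p4 p31 p22 p211 p1111 = all
    where
    pair : ∀ i k l a b c d → R (pt i a) (pt i b) (pt k c) (pt l d)
    pair i k l a b c d with i ≟ᵍ k | i ≟ᵍ l | k ≟ᵍ l
    ... | yes refl | yes refl | _        = p4 i a b c d
    ... | yes refl | no i≢l   | _        = p31 i l a b c d i≢l
    ... | no i≢k   | yes refl | _        = sym₃₄ (p31 i k a b d c i≢k)
    ... | no i≢k   | no _     | yes refl = p22 i k a b c d i≢k
    ... | no i≢k   | no i≢l   | no k≢l   = p211 i k l a b c d (i≢k , i≢l , k≢l)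

    all : ∀ i j k l a b c d → R (pt i a) (pt j b) (pt k c) (pt l d)
    all i j k l a b c d with i ≟ᵍ j | i ≟ᵍ k | i ≟ᵍ l | j ≟ᵍ k | j ≟ᵍ l | k ≟ᵍ l
    ... | yes refl | _ | _ | _ | _ | _ = pair i k l a b c d
    ... | _ | yes refl | _ | _ | _ | _ = sym₂₃ (pair i j l a c b d)
    ... | _ | _ | yes refl | _ | _ | _ = sym₃₄ (sym₂₃ (pair i j k a d b c))
    ... | _ | _ | _ | yes refl | _ | _ = sym₁₂ (sym₂₃ (pair j i l b c a d))
    ... | _ | _ | _ | _ | yes refl | _ = sym₃₄ (sym₁₂ (sym₂₃ (pair j i k b d a c)))
    ... | _ | _ | _ | _ | _ | yes refl = sym₂₃ (sym₃₄ (sym₁₂ (sym₂₃ (pair k i j c d a b))))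
    ... | no p | no q | no r | no s | no t | no u =
      p1111 i j k l a b c d ((p , q , s) , (r , t , u))

  -- Four distinct groups are all the groups there are, and they can be reordered so that the first
  -- two make up one half.
  by-halves :
    (∀ h ε ε′ a b c d → R (pt (h , ε) a) (pt (h , not ε) b) (pt (not h , ε′) c) (pt (not h , not ε′) d)) →
    ∀ i j k l a b c d → Distinct₄ i j k l → R (pt i a) (pt j b) (pt k c) (pt l d)
  by-halves halves = all
    where
    same-half : ∀ i j k l a b c d → Distinct₄ i j k l → proj₁ i ≡ proj₁ j →
                R (pt i a) (pt j b) (pt k c) (pt l d)
    same-half (h , ε) (_ , ε₁) (h₂ , ε₂) (h₃ , ε₃) a b c d ((p , q , r) , (s , t , u)) refl
      with refl ← ¬-not (λ (e : ε₁ ≡ ε) → p (cong (h ,_) (sym e)))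
      with refl ← other-half (q ∘ sym) (r ∘ sym)
      with refl ← other-half (s ∘ sym) (t ∘ sym)
      with refl ← ¬-not (λ (e : ε₃ ≡ ε₂) → u (cong (not h ,_) (sym e)))
      = halves h ε ε₂ a b c d

    all : ∀ i j k l a b c d → Distinct₄ i j k l → R (pt i a) (pt j b) (pt k c) (pt l d)
    all i j k l a b c d δ with proj₁ i ≟ᵇ proj₁ j | proj₁ i ≟ᵇ proj₁ k
    ... | yes e | _     = same-half i j k l a b c d δ e
    ... | no _  | yes e = sym₂₃ (same-half i k j l a c b d (Symmetric₄.sym₂₃ distinct₄-symmetric δ) e)
    -- There are only two halves, so the second and third group share the one that does not contain
    -- the first.
    ... | no p  | no q  = sym₁₂ (sym₂₃ (same-half j k i l b c a d
      (Symmetric₄.sym₂₃ distinct₄-symmetric (Symmetric₄.sym₁₂ distinct₄-symmetric δ))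
      (trans (¬-not (p ∘ sym)) (sym (¬-not (q ∘ sym))))))

-- The three splittings, and the uniformity of the whole family.

-- A permutation as `dir false` and its inverse as `dir true`, indexed so that `dir ε` leads from
-- the copy `ε` to the other copy.
record Bijection (A : Set) : Set where
  field
    dir     : Bool → A → A
    dir-inv : ∀ ε a → dir (not ε) (dir ε a) ≡ a

open Bijection

-- The three ways of splitting the four groups into two halves, each as an
-- involution taking it to the splitting by the first coordinate.
φ : Fin 3 → Group → Group
φ 0F i       = i
φ 1F (h , ε) = ε , h
φ 2F (h , ε) = h xor ε , ε

φ-invol : ∀ m i → φ m (φ m i) ≡ i
φ-invol 0F _ = refl
φ-invol 1F _ = refl
φ-invol 2F (false , false) = refl
φ-invol 2F (false , true)  = refl
φ-invol 2F (true  , false) = refl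
φ-invol 2F (true  , true)  = refl

φ-injective : ∀ m {i j} → φ m i ≡ φ m j → i ≡ j
φ-injective m {i} {j} e = trans (sym (φ-invol m i)) (trans (cong (φ m) e) (φ-invol m j))

-- Any two groups lie in the same half for exactly one of the three splittings.
together : ∀ i k → i ≢ k → ∀ v →
  select (does (proj₁ (φ 0F i) ≟ᵇ proj₁ (φ 0F k))) v +
  (select (does (proj₁ (φ 1F i) ≟ᵇ proj₁ (φ 1F k))) v +
   select (does (proj₁ (φ 2F i) ≟ᵇ proj₁ (φ 2F k))) v) ≡ v
together (false , false) (false , false) i≢k v = ⊥-elim (i≢k refl)
together (false , false) (false , true)  i≢k v = +-identityʳ v
together (false , false) (true  , false) i≢k v = +-identityʳ v
together (false , false) (true  , true)  i≢k v = refl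
together (false , true)  (false , false) i≢k v = +-identityʳ v
together (false , true)  (false , true)  i≢k v = ⊥-elim (i≢k refl)
together (false , true)  (true  , false) i≢k v = refl
together (false , true)  (true  , true)  i≢k v = +-identityʳ v
together (true  , false) (false , false) i≢k v = +-identityʳ v
together (true  , false) (false , true)  i≢k v = refl
together (true  , false) (true  , false) i≢k v = ⊥-elim (i≢k refl)
together (true  , false) (true  , true)  i≢k v = +-identityʳ v
together (true  , true)  (false , false) i≢k v = refl
together (true  , true)  (false , true)  i≢k v = +-identityʳ v
together (true  , true)  (true  , false) i≢k v = +-identityʳ v
together (true  , true)  (true  , true)  i≢k v = ⊥-elim (i≢k refl)

-- The lists `Ss`, `ts` and `us` index the systems of sort A, `πs` and `ss` those of sort B; `M`
-- stands for `μ` minus `γ`.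
module Family {r : ℕ} (S₀ : Skein (Fin (4 + r)))
  (Ss : List (Skein (Fin (4 + r)))) (ts : List (Fin (4 + r))) (us : List (Fin (3 + r)))
  (πs : List (Bijection (Fin (4 + r)))) (ss : List (Fin (4 + r)))
  (μ γ M : ℕ) where

  private
    F = Fin (4 + r)

  open Quadruple {suc (suc r)} S₀
  open Cyclic (suc (suc (suc r)))
  open Factorization (loop S₀) using (act; lab; act-lab; lab-act; lab-injective)

  infix 4 _≟ᵖ_

  _≟ᵖ_ : DecidableEquality Point
  _≟ᵖ_ = ≡-dec _≟ᵇ_ (≡-dec _≟ᵇ_ _≟ᶠ_)

  IndexA : Set
  IndexA = Skein F × (F × Fin (suc (suc (suc r))))

  -- Each type of 4-subset depends on one coordinate of the index only: type 4 on the system, type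
  -- 1111 on `t`, type 22 on `u`. Hence the lists may be paired entry by entry in any order. The
  -- same applies to `indicesB`.
  indicesA : List IndexA
  indicesA = zip Ss (zip ts us)

  skeinA : IndexA → Skein Point
  skeinA (S , (t , u)) = typeA S t u

  IndexB : Set
  IndexB = Bijection F × F

  indicesB : List IndexB
  indicesB = zip πs ss

  skeinB : F → IndexB → Skein Point
  skeinB t (π , s) = typeB t (dir π) (dir-inv π) s

  numberA : Point → Point → Point → Point → ℕ
  numberA = number _≟ᵖ_ (map skeinA indicesA)

  numberB : F → Point → Point → Point → Point → ℕ
  numberB t = number _≟ᵖ_ (map (skeinB t) indicesB)

  total : Point → F
  total = proj₂ ∘ proj₂

  sum₄ : Point → Point → Point → Point → F
  sum₄ x y z w = (total x ⊕ total y) ⊕ (total z ⊕ total w)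

  private
    sum₁₂ : ∀ x y z w → sum₄ x y z w ≡ sum₄ y x z w
    sum₁₂ x y z w = cong (_⊕ (total z ⊕ total w)) (⊕-comm (total x) (total y))

    sum₃₄ : ∀ x y z w → sum₄ x y z w ≡ sum₄ x y w z
    sum₃₄ x y z w = cong ((total x ⊕ total y) ⊕_) (⊕-comm (total z) (total w))

    sum₂₃ : ∀ x y z w → sum₄ x y z w ≡ sum₄ x z y w
    sum₂₃ (_ , _ , a) (_ , _ , b) (_ , _ , c) (_ , _ , d) = begin
      (a ⊕ b) ⊕ (c ⊕ d)  ≡⟨ ⊕-assoc a b (c ⊕ d) ⟩
      a ⊕ (b ⊕ (c ⊕ d))  ≡⟨ cong (a ⊕_) (⊕-assoc b c d) ⟨
      a ⊕ ((b ⊕ c) ⊕ d)  ≡⟨ cong (λ z → a ⊕ (z ⊕ d)) (⊕-comm b c) ⟩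
      a ⊕ ((c ⊕ b) ⊕ d)  ≡⟨ cong (a ⊕_) (⊕-assoc c b d) ⟩
      a ⊕ (c ⊕ (b ⊕ d))  ≡⟨ ⊕-assoc a c (b ⊕ d) ⟨
      (a ⊕ c) ⊕ (b ⊕ d)  ∎
      where open ≡-Reasoning

  by-sum : (Qs : List (Skein Point)) (f : F → ℕ) →
           Symmetric₄ (λ x y z w → number _≟ᵖ_ Qs x y z w ≡ f (sum₄ x y z w))
  by-sum Qs f = number-symmetric _≟ᵖ_ Qs (λ x y z w → f (sum₄ x y z w))
    (λ x y z w → cong f (sum₁₂ x y z w))
    (λ x y z w → cong f (sum₂₃ x y z w))
    (λ x y z w → cong f (sum₃₄ x y z w))

  module Uniform
    (length-ts : length Ss ≡ length ts) (length-us : length ts ≡ length us)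
    (length-ss : length πs ≡ length ss)
    (Ss-uniform : ∀ {a b c d} → Distinct₄ a b c d → number _≟ᶠ_ Ss a b c d ≡ μ)
    (us-uniform : ∀ v → count (_≟ᶠ v) us ≡ M)
    (M+γ≡μ : M + γ ≡ μ)
    -- Sort A leaves the entry sums 0, 1 and 2 to sort B, one to each splitting.
    (ts-uniform : ∀ v → count (_≟ᶠ v) ts +
       (select (does (v ≟ᶠ 0F)) μ + (select (does (v ≟ᶠ 1F)) μ + select (does (v ≟ᶠ 2F)) μ)) ≡ μ)
    (ss-uniform : ∀ v → count (_≟ᶠ v) ss ≡ μ)
    (πs-uniform : ∀ ε a c → count (λ π → dir π ε a ≟ᶠ c) πs ≡ μ)
    (πs-perpendicular : ∀ ε {a b c d} → a ≢ b → c ≢ d →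
       count (λ π → ((dir π ε a ≟ᶠ c) ×-dec (dir π ε b ≟ᶠ d)) ⊎-dec
                    ((dir π ε a ≟ᶠ d) ×-dec (dir π ε b ≟ᶠ c))) πs ≡ γ)
    where

    private
      length-zip-ts-us : length Ss ≡ length (zip ts us)
      length-zip-ts-us = trans length-ts (sym (length-zip ts us length-us))

    countA-ts : ∀ v → count (λ i → proj₁ (proj₂ i) ≟ᶠ v) indicesA ≡ count (_≟ᶠ v) ts
    countA-ts v = trans (count-zip₂ (λ tu → proj₁ tu ≟ᶠ v) Ss (zip ts us) length-zip-ts-us)
                        (count-zip₁ (_≟ᶠ v) ts us length-us)

    countA-us : ∀ v → count (λ i → proj₂ (proj₂ i) ≟ᶠ v) indicesA ≡ M
    countA-us v = trans (count-zip₂ (λ tu → proj₂ tu ≟ᶠ v) Ss (zip ts us) length-zip-ts-us)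
                 (trans (count-zip₂ (_≟ᶠ v) ts us length-us) (us-uniform v))

    numberA-4 : ∀ i {a b c d} → Distinct₄ a b c d →
                numberA (pt i a) (pt i b) (pt i c) (pt i d) ≡ μ
    numberA-4 i {a} {b} {c} {d} δ = trans
      (number-map _≟ᵖ_ skeinA (λ (S , _) → op S a b c ≟ᶠ d)
        (λ (S , t , u) → mk⇔ (λ e → pt-injective {i} (trans (sym (TypeA.type-4 S t u i a b c)) e))
                             (λ e → trans (TypeA.type-4 S t u i a b c) (cong (pt i) e))) indicesA)
      (trans (count-zip₁ (λ S → op S a b c ≟ᶠ d) Ss (zip ts us) length-zip-ts-us) (Ss-uniform δ))

    numberA-31 : ∀ i k a b c d → i ≢ k → numberA (pt i a) (pt i b) (pt i c) (pt k d) ≡ 0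
    numberA-31 i k a b c d i≢k = number-none _≟ᵖ_ skeinA
      (λ (S , t , u) e → i≢k (pt-group (trans (sym (TypeA.type-4 S t u i a b c)) e))) indicesA

    numberA-211 : ∀ i k l a b c d → Distinct₃ i k l →
                  numberA (pt i a) (pt i b) (pt k c) (pt l d) ≡ 0
    numberA-211 i k l a b c d (i≢k , _ , k≢l) = number-none _≟ᵖ_ skeinA
      (λ (S , t , u) e → k≢l (pt-group (trans (sym (TypeA.type-22 S t u i k a b c i≢k)) e))) indicesA

    -- Nonzero labels `suc x` and `suc y` are matched by exactly one reflection, the one whose `u`
    -- is the sum of `x` and `y`.
    numberA-22 : ∀ i k {a b c d} → i ≢ k → a ≢ b → c ≢ d →
                 numberA (pt i a) (pt i b) (pt k c) (pt k d) ≡ M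
    numberA-22 i k {a} {b} {c} {d} i≢k a≢b c≢d with lab a b in eq | lab c d in eq′
    ... | zero  | _     = ⊥-elim (a≢b (lab-injective eq))
    ... | suc _ | zero  = ⊥-elim (c≢d (lab-injective eq′))
    ... | suc x | suc y = trans
      (number-map _≟ᵖ_ skeinA (λ (_ , _ , u) → u ≟ᶠ (Cyc._⊕_ y x)) (λ (S , t , u) → mk⇔
        (λ e → Cyc.⊖≡⇒ (sucᶠ-injective (trans (reflected S t u e) eq′)))
        (λ e → trans (TypeA.type-22 S t u i k a b c i≢k) (cong (pt k)
          (trans (cong (λ l → act (reflect u l) c) eq)
          (trans (cong (λ l → act l c) (trans (cong suc (Cyc.⊖≡⇐ e)) (sym eq′))) (act-lab c d)))))) indicesA)
      (countA-us _)
      where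
      -- Nonzero labels are added in the group of order `3 + r`, entries in the group of order
      -- `4 + r`.
      module Cyc = Cyclic (suc (suc r))
      reflected : ∀ S t u → op (typeA S t u) (pt i a) (pt i b) (pt k c) ≡ pt k d →
                  reflect u (suc x) ≡ lab c d
      reflected S t u e = trans (cong (reflect u) (sym eq)) (trans (sym (lab-act (reflect u (lab a b)) c))
        (cong (lab c) (pt-injective {k} (trans (sym (TypeA.type-22 S t u i k a b c i≢k)) e))))

    numberA-1111 : ∀ i j k l a b c d → Distinct₄ i j k l →
      numberA (pt i a) (pt j b) (pt k c) (pt l d) ≡ count (_≟ᶠ ((a ⊕ b) ⊕ (c ⊕ d))) ts
    numberA-1111 = by-halves (by-sum (map skeinA indicesA) λ v → count (_≟ᶠ v) ts) λ h ε ε′ a b c d → trans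
      (number-map _≟ᵖ_ skeinA (λ (_ , t , _) → t ≟ᶠ ((a ⊕ b) ⊕ (c ⊕ d))) (λ (S , t , u) → mk⇔
        (λ e → trans (⊖≡⇒ (⊖≡⇒ (pt-injective {not h , not ε′} (trans (sym (TypeA.type-1111 S t u h ε ε′ a b c)) e))))
                     (rearrange a b c d))
        (λ e → trans (TypeA.type-1111 S t u h ε ε′ a b c) (cong (pt (not h , not ε′))
                     (⊖≡⇐ (⊖≡⇐ (trans e (sym (rearrange a b c d)))))))) indicesA)
      (countA-ts _)
      where
      rearrange : ∀ a b c d → (d ⊕ c) ⊕ (a ⊕ b) ≡ (a ⊕ b) ⊕ (c ⊕ d)
      rearrange a b c d = trans (⊕-comm (d ⊕ c) (a ⊕ b)) (cong ((a ⊕ b) ⊕_) (⊕-comm d c))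

    module _ (t : F) where

      countB-ss : ∀ v → count (λ i → proj₂ i ≟ᶠ v) indicesB ≡ μ
      countB-ss v = trans (count-zip₂ (_≟ᶠ v) πs ss length-ss) (ss-uniform v)

      private
        module B (i : IndexB) = TypeB t (dir (proj₁ i)) (dir-inv (proj₁ i)) (proj₂ i)

      numberB-4 : ∀ i {a b c} d → Distinct₃ a b c →
                  numberB t (pt i a) (pt i b) (pt i c) (pt i d) ≡ 0
      numberB-4 (h , ε) d δ = number-none _≟ᵖ_ (skeinB t)
        (λ i e → not-¬ refl (sym (cong (proj₁ ∘ proj₂) (trans (sym (B.type-31 i h ε δ)) e)))) indicesB

      numberB-31 : ∀ i k {a b c} d → i ≢ k → Distinct₃ a b c →
                   numberB t (pt i a) (pt i b) (pt i c) (pt k d) ≡ select (does (proj₁ i ≟ᵇ proj₁ k)) μ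
      numberB-31 (h , ε) (h′ , ε′) {a} {b} {c} d i≢k δ with h ≟ᵇ h′
      ... | no h≢h′ = number-none _≟ᵖ_ (skeinB t)
        (λ i e → h≢h′ (cong proj₁ (trans (sym (B.type-31 i h ε δ)) e))) indicesB
      ... | yes refl with refl ← ¬-not (λ (e : ε′ ≡ ε) → i≢k (cong (h ,_) (sym e))) = trans
        (number-map _≟ᵖ_ (skeinB t) (λ (π , _) → dir π ε (op S₀ a b c) ≟ᶠ d) (λ i → mk⇔
          (λ e → pt-injective {h , not ε} (trans (sym (B.type-31 i h ε δ)) e))
          (λ e → trans (B.type-31 i h ε δ) (cong (pt (h , not ε)) e))) indicesB)
        (trans (count-zip₁ (λ π → dir π ε (op S₀ a b c) ≟ᶠ d) πs ss length-ss)
               (πs-uniform ε (op S₀ a b c) d))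

      -- Within a half the permutations that take the first pair to the second are counted. Across
      -- halves the completion of `c` lies in the other group of its half, which excludes type 22.
      numberB-22 : ∀ i k {a b c d} → i ≢ k → a ≢ b → c ≢ d →
                   numberB t (pt i a) (pt i b) (pt k c) (pt k d) ≡ select (does (proj₁ i ≟ᵇ proj₁ k)) γ
      numberB-22 (h , ε) (h′ , ε′) {a} {b} {c} {d} i≢k a≢b c≢d with h ≟ᵇ h′
      ... | no h≢h′ with refl ← ¬-not (h≢h′ ∘ sym) = number-none _≟ᵖ_ (skeinB t)
        (λ i e → not-¬ refl (sym (cong (proj₁ ∘ proj₂) (trans (sym (B.type-211 i h ε ε′ c a≢b)) e)))) indicesB
      ... | yes refl with refl ← ¬-not (λ (e : ε′ ≡ ε) → i≢k (cong (h ,_) (sym e))) = trans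
        (number-map _≟ᵖ_ (skeinB t) _ (λ i → B.type-22 i h ε a≢b c≢d) indicesB)
        (trans (count-zip₁ (λ π → ((dir π ε a ≟ᶠ c) ×-dec (dir π ε b ≟ᶠ d)) ⊎-dec
                                  ((dir π ε a ≟ᶠ d) ×-dec (dir π ε b ≟ᶠ c))) πs ss length-ss)
               (πs-perpendicular ε a≢b c≢d))

      numberB-211 : ∀ i k l {a b} c d → Distinct₃ i k l → a ≢ b →
                   numberB t (pt i a) (pt i b) (pt k c) (pt l d) ≡ select (does (proj₁ k ≟ᵇ proj₁ l)) μ
      numberB-211 (h , ε) (h′ , ε′) (h″ , ε″) {a} {b} c d (i≢k , i≢l , k≢l) a≢b with h′ ≟ᵇ h″
      ... | yes refl
        with refl ← ¬-not (λ (e : ε″ ≡ ε′) → k≢l (cong (h′ ,_) (sym e)))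
        with refl ← trans (sym (not-involutive h′)) (cong not (sym (other-half {h′} {ε′} i≢k i≢l))) = trans
          (number-map _≟ᵖ_ (skeinB t) (λ (_ , s) → s ≟ᶠ solution h) (λ i → mk⇔
            (λ e → to h i (⊖≡⇒ (pt-injective {not h , not ε′} (trans (sym (B.type-211 i h ε ε′ c a≢b)) e))))
            (λ e → trans (B.type-211 i h ε ε′ c a≢b) (cong (pt (not h , not ε′)) (⊖≡⇐ (from h i e))))) indicesB)
          (countB-ss (solution h))
        where
        -- The chosen cross sum of the half containing `c` and `d` must be `v`; it is `t ⊖ s` when
        -- `h` is `false` and `s` when `h` is `true`.
        v = (d ⊕ c) ⊖ lab a b
        solution : Bool → F
        solution false = t ⊖ v
        solution true  = v
        to-v : ∀ {s} → lab a b ⊕ s ≡ d ⊕ c → s ≡ v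
        to-v e = sym (⊖≡⇐ (trans (sym e) (⊕-comm _ _)))
        to : ∀ h i → lab a b ⊕ B.s[_] i (not h) ≡ d ⊕ c → proj₂ i ≡ solution h
        to false i e = trans (sym (⊖-invol t _)) (cong (t ⊖_) (to-v e))
        to true  i e = to-v e
        from-v : ∀ {s} → s ≡ v → lab a b ⊕ s ≡ d ⊕ c
        from-v refl = trans (⊕-comm _ _) (⊖-⊕ (d ⊕ c) (lab a b))
        from : ∀ h i → proj₂ i ≡ solution h → lab a b ⊕ B.s[_] i (not h) ≡ d ⊕ c
        from false i e = from-v (trans (cong (t ⊖_) e) (⊖-invol t v))
        from true  i e = from-v e
      ... | no h′≢h″ with h ≟ᵇ h′
      ...   | yes refl with refl ← ¬-not (λ (e : ε′ ≡ ε) → i≢k (cong (h ,_) (sym e))) =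
        number-none _≟ᵖ_ (skeinB t)
          (λ i e → h′≢h″ (cong proj₁ (trans (sym (B.within-half i h _ _ _)) e))) indicesB
      ...   | no h≢h′ with refl ← ¬-not (h≢h′ ∘ sym) =
        number-none _≟ᵖ_ (skeinB t)
          (λ i e → h′≢h″ (cong proj₁ (trans (sym (B.type-211 i h ε ε′ c a≢b)) e))) indicesB

      -- The two halves must have the sums `s` and `t ⊖ s`. The first condition determines `s`, and
      -- the second then says that the entry sum is `t`, a condition on the points alone.
      numberB-1111 : ∀ i j k l a b c d → Distinct₄ i j k l →
        numberB t (pt i a) (pt j b) (pt k c) (pt l d) ≡ select (does (((a ⊕ b) ⊕ (c ⊕ d)) ≟ᶠ t)) μ
      numberB-1111 = by-halves (by-sum (map (skeinB t) indicesB) λ v → select (does (v ≟ᶠ t)) μ)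
        λ h ε ε′ a b c d → trans
          (number-map _≟ᵖ_ (skeinB t)
            (λ (_ , s) → (s ≟ᶠ solution h a b c d) ×-dec (((a ⊕ b) ⊕ (c ⊕ d)) ≟ᶠ t))
            (λ i → mk⇔ (to h a b c d i ∘ Equivalence.to (B.type-1111 i h ε ε′ a b c d))
                       (Equivalence.from (B.type-1111 i h ε ε′ a b c d) ∘ from h a b c d i)) indicesB)
          (trans (count-×-const (λ (_ , s) → s ≟ᶠ solution h a b c d) (((a ⊕ b) ⊕ (c ⊕ d)) ≟ᶠ t) indicesB)
                 (cong (select _) (countB-ss (solution h a b c d))))
        where
        solution : Bool → (a b c d : F) → F
        solution false a b c d = a ⊕ b
        solution true  a b c d = c ⊕ d
        to : ∀ h a b c d i → a ⊕ b ≡ B.s[_] i h × c ⊕ d ≡ B.s[_] i (not h) →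
             proj₂ i ≡ solution h a b c d × (a ⊕ b) ⊕ (c ⊕ d) ≡ t
        to false a b c d (_ , s) (e , e′) = sym e , trans (cong₂ _⊕_ e e′) (trans (⊕-comm s (t ⊖ s)) (⊖-⊕ t s))
        to true  a b c d (_ , s) (e , e′) = sym e′ , trans (cong₂ _⊕_ e e′) (⊖-⊕ t s)
        from : ∀ h a b c d i → proj₂ i ≡ solution h a b c d × (a ⊕ b) ⊕ (c ⊕ d) ≡ t →
               a ⊕ b ≡ B.s[_] i h × c ⊕ d ≡ B.s[_] i (not h)
        from false a b c d (_ , s) (e , e′) = sym e , sym (⊖≡⇐ (trans (sym e′)
          (trans (cong (_⊕ (c ⊕ d)) (sym e)) (⊕-comm s (c ⊕ d)))))
        from true  a b c d (_ , s) (e , e′) = sym (⊖≡⇐ (trans (sym e′) (cong ((a ⊕ b) ⊕_) (sym e)))) , sym e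

    φᵖ : Fin 3 → Point → Point
    φᵖ m (h , (ε , a)) = pt (φ m (h , ε)) a

    φᵖ-invol : ∀ m x → φᵖ m (φᵖ m x) ≡ x
    φᵖ-invol m (h , (ε , a)) = cong (λ i → pt i a) (φ-invol m (h , ε))

    -- The entry sum that the splitting takes over in type 1111.
    shift : Fin 3 → F
    shift 0F = 0F
    shift 1F = 1F
    shift 2F = 2F

    familyB : Fin 3 → List (Skein Point)
    familyB m = map (conjugate (φᵖ m) (φᵖ m) (φᵖ-invol m) (φᵖ-invol m)) (map (skeinB (shift m)) indicesB)

    family : List (Skein Point)
    family = map skeinA indicesA ++ (familyB 0F ++ (familyB 1F ++ familyB 2F))

    number-familyB : ∀ m i j k l {a b c d v} →
      numberB (shift m) (pt (φ m i) a) (pt (φ m j) b) (pt (φ m k) c) (pt (φ m l) d) ≡ v →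
      number _≟ᵖ_ (familyB m) (pt i a) (pt j b) (pt k c) (pt l d) ≡ v
    number-familyB m i j k l {a} {b} {c} {d} = trans
      (number-map _≟ᵖ_ (conjugate (φᵖ m) (φᵖ m) (φᵖ-invol m) (φᵖ-invol m))
        (λ S → op S (pt (φ m i) a) (pt (φ m j) b) (pt (φ m k) c) ≟ᵖ pt (φ m l) d)
        (λ S → mk⇔ (λ e → trans (sym (φᵖ-invol m _)) (cong (φᵖ m) e))
                   (λ e → trans (cong (φᵖ m) e) (φᵖ-invol m _)))
        (map (skeinB (shift m)) indicesB))

    number-family : ∀ {x y z w A B₀ B₁ B₂} → numberA x y z w ≡ A →
      number _≟ᵖ_ (familyB 0F) x y z w ≡ B₀ → number _≟ᵖ_ (familyB 1F) x y z w ≡ B₁ →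
      number _≟ᵖ_ (familyB 2F) x y z w ≡ B₂ →
      number _≟ᵖ_ family x y z w ≡ A + (B₀ + (B₁ + B₂))
    number-family {x} {y} {z} {w} refl refl refl refl = trans (count-++ P? (map skeinA indicesA) _)
      (cong (numberA x y z w +_) (trans (count-++ P? (familyB 0F) _)
        (cong (number _≟ᵖ_ (familyB 0F) x y z w +_) (count-++ P? (familyB 1F) _))))
      where
      P? = λ S → op S x y z ≟ᵖ w

    φ-distinct₃ : ∀ m {i j k} → Distinct₃ i j k → Distinct₃ (φ m i) (φ m j) (φ m k)
    φ-distinct₃ m (p , q , r) = p ∘ φ-injective m , q ∘ φ-injective m , r ∘ φ-injective m

    φ-distinct₄ : ∀ m {i j k l} → Distinct₄ i j k l → Distinct₄ (φ m i) (φ m j) (φ m k) (φ m l)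
    φ-distinct₄ m (d , (p , q , r)) = φ-distinct₃ m d , (p ∘ φ-injective m , q ∘ φ-injective m , r ∘ φ-injective m)

    family-uniform : ∀ {x y z w} → Distinct₄ x y z w → number _≟ᵖ_ family x y z w ≡ μ
    family-uniform {h , ε , a} {h₁ , ε₁ , b} {h₂ , ε₂ , c} {h₃ , ε₃ , d} = by-type
      -- Distinctness is carried as a premise, so that a reordering of the points permutes it as
      -- well.
      (implies-symmetric distinct₄-symmetric
        (number-symmetric _≟ᵖ_ family (λ _ _ _ _ → μ) (λ _ _ _ _ → refl) (λ _ _ _ _ → refl) (λ _ _ _ _ → refl)))
      (λ i a b c d ((p , q , r) , (s , t , u)) →
        let δ = p ∘ cong (pt i) , q ∘ cong (pt i) , r ∘ cong (pt i)
            B-zero = λ m → number-familyB m i i i i (numberB-4 (shift m) (φ m i) d δ)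
        in trans (number-family (numberA-4 i (δ , (s ∘ cong (pt i) , t ∘ cong (pt i) , u ∘ cong (pt i))))
                                (B-zero 0F) (B-zero 1F) (B-zero 2F))
                 (+-identityʳ μ))
      (λ i k a b c d i≢k ((p , q , r) , _) →
        let B-value = λ m → number-familyB m i i i k (numberB-31 (shift m) (φ m i) (φ m k) d (i≢k ∘ φ-injective m)
                              (p ∘ cong (pt i) , q ∘ cong (pt i) , r ∘ cong (pt i)))
        in trans (number-family (numberA-31 i k a b c d i≢k) (B-value 0F) (B-value 1F) (B-value 2F))
                 (together i k i≢k μ))
      (λ i k a b c d i≢k ((p , _ , _) , (_ , _ , u)) →
        let a≢b = p ∘ cong (pt i)
            c≢d = u ∘ cong (pt k)
            B-value = λ m → number-familyB m i i k k
                        (numberB-22 (shift m) (φ m i) (φ m k) (i≢k ∘ φ-injective m) a≢b c≢d)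
        in trans (number-family (numberA-22 i k i≢k a≢b c≢d) (B-value 0F) (B-value 1F) (B-value 2F))
                 (trans (cong (M +_) (together i k i≢k γ)) M+γ≡μ))
      (λ i k l a b c d δ ((p , _ , _) , _) →
        let B-value = λ m → number-familyB m i i k l
                        (numberB-211 (shift m) (φ m i) (φ m k) (φ m l) c d (φ-distinct₃ m δ) (p ∘ cong (pt i)))
        in trans (number-family (numberA-211 i k l a b c d δ) (B-value 0F) (B-value 1F) (B-value 2F))
                 (together k l (proj₂ (proj₂ δ)) μ))
      (λ i j k l a b c d δ _ →
        let B-value = λ m → number-familyB m i j k l
                        (numberB-1111 (shift m) (φ m i) (φ m j) (φ m k) (φ m l) a b c d (φ-distinct₄ m δ))
        in trans (number-family (numberA-1111 i j k l a b c d δ) (B-value 0F) (B-value 1F) (B-value 2F))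
                 (ts-uniform ((a ⊕ b) ⊕ (c ⊕ d))))
      (h , ε) (h₁ , ε₁) (h₂ , ε₂) (h₃ , ε₃) a b c d

-- Subsets and blocks

private
  variable
    n : ℕ

set : List (Fin n) → Subset n
set = foldr (λ x p → ⁅ x ⁆ ∪ p) ⊥

∈-set⁺ : ∀ {x : Fin n} xs → x ∈ xs → x ∈ˢ set xs
∈-set⁺ (_ ∷ _) (here refl) = x∈p∪q⁺ (inj₁ (x∈⁅x⁆ _))
∈-set⁺ (_ ∷ xs) (there x∈) = x∈p∪q⁺ (inj₂ (∈-set⁺ xs x∈))

∈-set⁻ : ∀ {x : Fin n} xs → x ∈ˢ set xs → x ∈ xs
∈-set⁻ []       x∈ = ⊥-elim (∉⊥ x∈)
∈-set⁻ (y ∷ ys) x∈ with x∈p∪q⁻ ⁅ y ⁆ (set ys) x∈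
... | inj₁ x∈y  = here (x∈⁅y⁆⇒x≡y y x∈y)
... | inj₂ x∈ys = there (∈-set⁻ ys x∈ys)

set-swap : ∀ (x y : Fin n) xs → set (x ∷ y ∷ xs) ≡ set (y ∷ x ∷ xs)
set-swap x y xs = trans (sym (∪-assoc ⁅ x ⁆ ⁅ y ⁆ (set xs)))
  (trans (cong (_∪ set xs) (∪-comm ⁅ x ⁆ ⁅ y ⁆)) (∪-assoc ⁅ y ⁆ ⁅ x ⁆ (set xs)))

∣⁅x⁆∪p∣ : ∀ {x : Fin n} {p} → x ∉ˢ p → ∣ ⁅ x ⁆ ∪ p ∣ ≡ suc ∣ p ∣
∣⁅x⁆∪p∣ {x = zero}  {inside  ∷ p} x∉p = ⊥-elim (x∉p here)
∣⁅x⁆∪p∣ {x = zero}  {outside ∷ p} x∉p = cong (suc ∘ ∣_∣) (∪-identityˡ p)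
∣⁅x⁆∪p∣ {x = suc x} {inside  ∷ p} x∉p = cong suc (∣⁅x⁆∪p∣ (x∉p ∘ there))
∣⁅x⁆∪p∣ {x = suc x} {outside ∷ p} x∉p = ∣⁅x⁆∪p∣ (x∉p ∘ there)

∣set∣ : ∀ {xs : List (Fin n)} → Unique xs → ∣ set xs ∣ ≡ length xs
∣set∣ {n} [] = ∣⊥∣≡0 n
∣set∣ {xs = x ∷ xs} (x∉ ∷ u) =
  trans (∣⁅x⁆∪p∣ (λ x∈ → All.lookup x∉ (∈-set⁻ xs x∈) refl)) (cong suc (∣set∣ u))

split : ∀ {x : Fin n} {p} → x ∈ˢ p → ∃[ q ] x ∉ˢ q × p ≡ ⁅ x ⁆ ∪ q
split {p = _ ∷ p} here = outside ∷ p , (λ ()) , cong (inside ∷_) (sym (∪-identityˡ p))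
split {p = s ∷ p} (there x∈p) with q , x∉q , refl ← split x∈p =
  s ∷ q , (λ { (there x∈q) → x∉q x∈q }) , refl

-- With `xs` empty it enumerates a set of known size; with `xs` a triple inside a block it finds the
-- fourth point.
extend : ∀ (xs : List (Fin n)) k {p} → Unique xs → (∀ {x} → x ∈ xs → x ∈ˢ p) →
         ∣ p ∣ ≡ length xs + k → ∃[ ys ] length ys ≡ k × Unique (xs ++ ys) × p ≡ set (xs ++ ys)
extend [] k {p} _ _ e with nonempty? p
extend [] zero {p} _ _ e | no empty = [] , refl , [] , Empty-unique empty
extend {n} [] (suc k) {p} _ _ e | no empty
  with () ← trans (sym (∣⊥∣≡0 n)) (trans (cong ∣_∣ (sym (Empty-unique empty))) e)
extend [] k {p} _ _ e | yes (x , x∈p) with split x∈p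
extend [] zero _ _ e | yes (x , _) | q , x∉q , refl with () ← trans (sym (∣⁅x⁆∪p∣ x∉q)) e
extend [] (suc k) _ _ e | yes (x , _) | q , x∉q , refl
  with ys , e′ , u , refl ← extend [] k {q} [] (λ ()) (suc-injective (trans (sym (∣⁅x⁆∪p∣ x∉q)) e)) =
  x ∷ ys , cong suc e′ , All.tabulate (λ y∈ → λ { refl → x∉q (∈-set⁺ _ y∈) }) ∷ u , refl
extend (x ∷ xs) k (x∉ ∷ u) xs⊆p e with q , x∉q , refl ← split (xs⊆p (here refl))
  with ys , e′ , u′ , refl ← extend xs k {q} u
         (λ {y} y∈ → [ (λ y∈x → ⊥-elim (All.lookup x∉ y∈ (sym (x∈⁅y⁆⇒x≡y x y∈x)))) , (λ y∈q → y∈q) ]′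
                       (x∈p∪q⁻ ⁅ x ⁆ q (xs⊆p (there y∈))))
         (suc-injective (trans (sym (∣⁅x⁆∪p∣ x∉q)) e)) =
  ys , e′ , All.tabulate (λ y∈ → λ { refl → x∉q (∈-set⁺ _ y∈) }) ∷ u′ , refl

unique₃ : ∀ {a b c : Fin n} → Distinct₃ a b c → Unique (a ∷ b ∷ c ∷ [])
unique₃ (p , q , r) = (p ∷ q ∷ []) ∷ (r ∷ []) ∷ [] ∷ []

unique₄ : ∀ {a b c d : Fin n} → Distinct₄ a b c d → Unique (a ∷ b ∷ c ∷ d ∷ [])
unique₄ ((p , q , r) , (s , t , u)) = (p ∷ q ∷ s ∷ []) ∷ (r ∷ t ∷ []) ∷ (u ∷ []) ∷ [] ∷ []

distinct₃ : ∀ {a b c : Fin n} → Unique (a ∷ b ∷ c ∷ []) → Distinct₃ a b c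
distinct₃ ((p ∷ q ∷ []) ∷ (r ∷ []) ∷ [] ∷ []) = p , q , r

distinct₄ : ∀ {a b c d : Fin n} → Unique (a ∷ b ∷ c ∷ d ∷ []) → Distinct₄ a b c d
distinct₄ ((p ∷ q ∷ s ∷ []) ∷ (r ∷ t ∷ []) ∷ (u ∷ []) ∷ [] ∷ []) = (p , q , r) , (s , t , u)

quad : Fin n → Fin n → Fin n → Fin n → Subset n
quad a b c d = set (a ∷ b ∷ c ∷ d ∷ [])

last-∈ : ∀ {x a b c d : Fin n} → x ≢ a → x ≢ b → x ≢ c → x ∈ˢ quad a b c d → x ≡ d
last-∈ {a = a} {b} {c} {d} p q r x∈ with ∈-set⁻ (a ∷ b ∷ c ∷ d ∷ []) x∈
... | here e = ⊥-elim (p e)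
... | there (here e) = ⊥-elim (q e)
... | there (there (here e)) = ⊥-elim (r e)
... | there (there (there (here e))) = e

triple⊆quad : ∀ {a b c d : Fin n} → set (a ∷ b ∷ c ∷ []) ⊆ quad a b c d
triple⊆quad {a = a} {b} {c} {d} x∈ with ∈-set⁻ (a ∷ b ∷ c ∷ []) x∈
... | here e = ∈-set⁺ (a ∷ b ∷ c ∷ d ∷ []) (here e)
... | there (here e) = ∈-set⁺ (a ∷ b ∷ c ∷ d ∷ []) (there (here e))
... | there (there (here e)) = ∈-set⁺ (a ∷ b ∷ c ∷ d ∷ []) (there (there (here e)))

×-symmetric : {P : Set} {R R′ : P → P → P → P → Set} → Symmetric₄ R → Symmetric₄ R′ →
              Symmetric₄ (λ x y z w → R x y z w × R′ x y z w)
×-symmetric R R′ = record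
  { sym₁₂ = λ (r , r′) → Symmetric₄.sym₁₂ R r , Symmetric₄.sym₁₂ R′ r′
  ; sym₂₃ = λ (r , r′) → Symmetric₄.sym₂₃ R r , Symmetric₄.sym₂₃ R′ r′
  ; sym₃₄ = λ (r , r′) → Symmetric₄.sym₃₄ R r , Symmetric₄.sym₃₄ R′ r′
  }

quad-symmetric : (Q : Subset n → Set) → Symmetric₄ (λ a b c d → Q (quad a b c d))
quad-symmetric Q = record
  { sym₁₂ = λ {a} {b} {c} {d} → subst Q (set-swap a b (c ∷ d ∷ []))
  ; sym₂₃ = λ {a} {b} {c} {d} → subst Q (cong (⁅ a ⁆ ∪_) (set-swap b c (d ∷ [])))
  ; sym₃₄ = λ {a} {b} {c} {d} → subst Q (cong (λ p → ⁅ a ⁆ ∪ (⁅ b ⁆ ∪ p)) (set-swap c d []))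
  }

op-symmetric : {P : Set} (S : Skein P) → Symmetric₄ (λ x y z w → op S x y z ≡ w)
op-symmetric S = record
  { sym₁₂ = λ {x} {y} {z} → trans (swap₁₂ S y x z)
  ; sym₂₃ = λ {x} {y} {z} → trans (swap₂₃ S x z y)
  ; sym₃₄ = op≡-swap₃₄ S
  }

-- Passage between operations and Steiner systems.

module FromSkein (S : Skein (Fin n)) where

  private
    IsBlock : Subset n → Set
    IsBlock p = ∃[ a ] ∃[ b ] ∃[ c ] Distinct₃ a b c × p ≡ quad a b c (op S a b c)

    distinct₄-op : ∀ {a b c} → Distinct₃ a b c → Distinct₄ a b c (op S a b c)
    distinct₄-op {a} {b} {c} d = d ,
      proj₁ (proj₂ (distinct-op S d)) ,
      proj₂ (proj₂ (distinct-op S d)) ,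
      subst (c ≢_) (swap₂₃ S a c b) (proj₂ (proj₂ (distinct-op S (distinct-swap₂₃ d))))

    module _ (p : Subset n) where

      Spans : Fin n → Fin n → Fin n → Fin n → Set
      Spans a b c d = op S a b c ≡ d × p ≡ quad a b c d

      open Symmetric₄ (×-symmetric (op-symmetric S) (quad-symmetric (p ≡_)))

      -- `Spans` is symmetric, so a given point of `p` can be brought to the front; `front₂` and
      -- `front₃` do so without disturbing the points already placed.
      front₁ : ∀ {a b c d x} → Spans a b c d → x ∈ˢ p → ∃[ b ] ∃[ c ] ∃[ d ] Spans x b c d
      front₁ {a} {b} {c} {d} s@(_ , refl) x∈ with ∈-set⁻ (a ∷ b ∷ c ∷ d ∷ []) x∈
      ... | here refl = _ , _ , _ , s
      ... | there (here refl) = _ , _ , _ , sym₁₂ s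
      ... | there (there (here refl)) = _ , _ , _ , sym₁₂ (sym₂₃ s)
      ... | there (there (there (here refl))) = _ , _ , _ , sym₁₂ (sym₂₃ (sym₃₄ s))

      front₂ : ∀ {x b c d y} → Spans x b c d → y ∈ˢ p → x ≢ y → ∃[ c ] ∃[ d ] Spans x y c d
      front₂ {x} {b} {c} {d} s@(_ , refl) y∈ x≢y with ∈-set⁻ (x ∷ b ∷ c ∷ d ∷ []) y∈
      ... | here refl = ⊥-elim (x≢y refl)
      ... | there (here refl) = _ , _ , s
      ... | there (there (here refl)) = _ , _ , sym₂₃ s
      ... | there (there (there (here refl))) = _ , _ , sym₂₃ (sym₃₄ s)

      front₃ : ∀ {x y c d z} → Spans x y c d → z ∈ˢ p → x ≢ z → y ≢ z → ∃[ d ] Spans x y z d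
      front₃ {x} {y} {c} {d} s@(_ , refl) z∈ x≢z y≢z with ∈-set⁻ (x ∷ y ∷ c ∷ d ∷ []) z∈
      ... | here refl = ⊥-elim (x≢z refl)
      ... | there (here refl) = ⊥-elim (y≢z refl)
      ... | there (there (here refl)) = _ , s
      ... | there (there (there (here refl))) = _ , sym₃₄ s

    -- Bringing `x`, `y`, `z` to the front shows that any three points of a block recover it, which
    -- is the uniqueness in `covers`.
    block-through : ∀ {p x y z} → IsBlock p → Distinct₃ x y z → x ∈ˢ p → y ∈ˢ p → z ∈ˢ p →
                    p ≡ quad x y z (op S x y z)
    block-through {p} (a , b , c , _ , e) (x≢y , x≢z , y≢z) x∈ y∈ z∈
      with _ , _ , _ , s ← front₁ p (refl , e) x∈
      with _ , _ , s ← front₂ p s y∈ x≢y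
      with _ , refl , e′ ← front₃ p s z∈ x≢z y≢z = e′

  system : SteinerSystem 3 4 n
  system = record
    { Block = IsBlock
    ; block? = λ p → any? λ a → any? λ b → any? λ c →
        distinct? _≟ᶠ_ a b c ×-dec (p ≟ˢ quad a b c (op S a b c))
    ; block-size = λ { (a , b , c , d , refl) → ∣set∣ (unique₄ (distinct₄-op d)) }
    ; covers = cover
    }
    where
    cover : ∀ T → ∣ T ∣ ≡ 3 → ∃! _≡_ λ p → IsBlock p × T ⊆ p
    cover T e with extend [] 3 {T} [] (λ ()) e
    ... | x ∷ y ∷ z ∷ [] , _ , u , refl =
      quad x y z (op S x y z) , ((x , y , z , distinct₃ u , refl) , triple⊆quad) ,
      λ (blk , T⊆) → sym (block-through blk (distinct₃ u)
        (T⊆ (∈-set⁺ xyz (here refl))) (T⊆ (∈-set⁺ xyz (there (here refl))))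
        (T⊆ (∈-set⁺ xyz (there (there (here refl))))))
      where xyz = x ∷ y ∷ z ∷ []

  block⇔op : ∀ {x y z w} → Distinct₄ x y z w → Block system (quad x y z w) ⇔ op S x y z ≡ w
  block⇔op {x} {y} {z} {w} (d , (x≢w , y≢w , z≢w)) = mk⇔
    (λ blk → sym (last-∈ (x≢w ∘ sym) (y≢w ∘ sym) (z≢w ∘ sym)
      (subst (w ∈ˢ_) (block-through blk d (∈-set⁺ xyzw (here refl)) (∈-set⁺ xyzw (there (here refl)))
                                          (∈-set⁺ xyzw (there (there (here refl)))))
             (∈-set⁺ xyzw (there (there (there (here refl))))))))
    (λ { refl → x , y , z , d , refl })
    where xyzw = x ∷ y ∷ z ∷ w ∷ []

-- Once the graph is symmetric, each law of the operation compares two values for the same three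
-- arguments and follows from uniqueness.
skeinFromRelation : {P : Set} {R : P → P → P → P → Set} → Symmetric₄ R →
  (∀ x y z → ∃ (R x y z)) → (∀ {x y z w w′} → R x y z w → R x y z w′ → w ≡ w′) →
  (∀ x y → R x x y y) → Skein P
skeinFromRelation {R = R} R-sym total unique diagonal = record
  { op     = λ x y z → proj₁ (total x y z)
  ; swap₁₂ = λ x y z → unique (proj₂ (total x y z)) (sym₁₂ (proj₂ (total y x z)))
  ; swap₂₃ = λ x y z → unique (proj₂ (total x y z)) (sym₂₃ (proj₂ (total x z y)))
  ; absorb = λ x y → unique (proj₂ (total x x y)) (diagonal x y)
  ; invol  = λ x y z → unique (proj₂ (total x y _)) (sym₃₄ (proj₂ (total x y z)))
  }
  where open Symmetric₄ R-sym

-- The graph of `op` on triples with a repetition: the four entries fall into two pairs of equal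
-- ones.
Degenerate : {A : Set} → A → A → A → A → Set
Degenerate a b c d = (a ≡ b × c ≡ d) ⊎ ((a ≡ c × b ≡ d) ⊎ (b ≡ c × a ≡ d))

degenerate-symmetric : {A : Set} → Symmetric₄ (Degenerate {A})
degenerate-symmetric = record
  { sym₁₂ = λ { (inj₁ (refl , refl)) → inj₁ (refl , refl)
              ; (inj₂ (inj₁ (refl , refl))) → inj₂ (inj₂ (refl , refl))
              ; (inj₂ (inj₂ (refl , refl))) → inj₂ (inj₁ (refl , refl)) }
  ; sym₂₃ = λ { (inj₁ (refl , refl)) → inj₂ (inj₁ (refl , refl))
              ; (inj₂ (inj₁ (refl , refl))) → inj₁ (refl , refl)
              ; (inj₂ (inj₂ (refl , refl))) → inj₂ (inj₂ (refl , refl)) }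
  ; sym₃₄ = λ { (inj₁ (refl , refl)) → inj₁ (refl , refl)
              ; (inj₂ (inj₁ (refl , refl))) → inj₂ (inj₂ (refl , refl))
              ; (inj₂ (inj₂ (refl , refl))) → inj₂ (inj₁ (refl , refl)) }
  }

¬degenerate : {A : Set} {a b c d : A} → Distinct₃ a b c → ¬ Degenerate a b c d
¬degenerate (p , q , r) (inj₁ (e , _))        = p e
¬degenerate (p , q , r) (inj₂ (inj₁ (e , _))) = q e
¬degenerate (p , q , r) (inj₂ (inj₂ (e , _))) = r e

degenerate-unique : {A : Set} {a b c d d′ : A} → Degenerate a b c d → Degenerate a b c d′ → d ≡ d′
degenerate-unique (inj₁ (refl , refl))        (inj₁ (_ , e))               = e
degenerate-unique (inj₁ (refl , refl))        (inj₂ (inj₁ (refl , refl)))  = refl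
degenerate-unique (inj₁ (refl , refl))        (inj₂ (inj₂ (refl , refl)))  = refl
degenerate-unique (inj₂ (inj₁ (refl , refl))) (inj₁ (refl , refl))         = refl
degenerate-unique (inj₂ (inj₁ (refl , refl))) (inj₂ (inj₁ (_ , e)))        = e
degenerate-unique (inj₂ (inj₁ (refl , refl))) (inj₂ (inj₂ (refl , refl)))  = refl
degenerate-unique (inj₂ (inj₂ (refl , refl))) (inj₁ (refl , refl))         = refl
degenerate-unique (inj₂ (inj₂ (refl , refl))) (inj₂ (inj₁ (refl , refl)))  = refl
degenerate-unique (inj₂ (inj₂ (refl , refl))) (inj₂ (inj₂ (_ , e)))        = e

module ToSkein (𝒮 : SteinerSystem 3 4 n) where

  private
    Proper : Fin n → Fin n → Fin n → Fin n → Set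
    Proper a b c d = Distinct₄ a b c d × Block 𝒮 (quad a b c d)

    Completes : Fin n → Fin n → Fin n → Fin n → Set
    Completes a b c d = Proper a b c d ⊎ Degenerate a b c d

    completes-symmetric : Symmetric₄ Completes
    completes-symmetric = record
      { sym₁₂ = Sum.map (sym₁₂ proper) (sym₁₂ degenerate-symmetric)
      ; sym₂₃ = Sum.map (sym₂₃ proper) (sym₂₃ degenerate-symmetric)
      ; sym₃₄ = Sum.map (sym₃₄ proper) (sym₃₄ degenerate-symmetric)
      }
      where
      open Symmetric₄
      proper : Symmetric₄ Proper
      proper = ×-symmetric distinct₄-symmetric (quad-symmetric (Block 𝒮))

    complete : ∀ {a b c} → Distinct₃ a b c → ∃ (Proper a b c)
    complete {a} {b} {c} δ
      with S , (blk , T⊆S) , _ ← covers 𝒮 (set (a ∷ b ∷ c ∷ [])) (∣set∣ (unique₃ δ))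
      with d ∷ [] , _ , u , refl ← extend (a ∷ b ∷ c ∷ []) 1 {S} (unique₃ δ) (T⊆S ∘ ∈-set⁺ _) (block-size 𝒮 blk)
      = d , distinct₄ u , blk

    proper-unique : ∀ {a b c d d′} → Proper a b c d → Proper a b c d′ → d ≡ d′
    proper-unique {a} {b} {c} {d} {d′} ((δ , (p , q , r)) , blk) (_ , blk′)
      with _ , _ , unique ← covers 𝒮 (set (a ∷ b ∷ c ∷ [])) (∣set∣ (unique₃ δ)) =
      last-∈ (p ∘ sym) (q ∘ sym) (r ∘ sym)
        (subst (d ∈ˢ_) (trans (sym (unique (blk , triple⊆quad))) (unique (blk′ , triple⊆quad)))
               (∈-set⁺ (a ∷ b ∷ c ∷ d ∷ []) (there (there (there (here refl))))))

    completion : ∀ a b c → ∃ (Completes a b c)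
    completion a b c with a ≟ᶠ b | a ≟ᶠ c | b ≟ᶠ c
    ... | yes e | _     | _     = c , inj₂ (inj₁ (e , refl))
    ... | no _  | yes e | _     = b , inj₂ (inj₂ (inj₁ (e , refl)))
    ... | no _  | no _  | yes e = a , inj₂ (inj₂ (inj₂ (e , refl)))
    ... | no p  | no q  | no r  with d , proper ← complete (p , q , r) = d , inj₁ proper

    completion-unique : ∀ {a b c d d′} → Completes a b c d → Completes a b c d′ → d ≡ d′
    completion-unique (inj₁ p)       (inj₁ p′) = proper-unique p p′
    completion-unique (inj₁ (δ , _)) (inj₂ q′) = ⊥-elim (¬degenerate (proj₁ δ) q′)
    completion-unique (inj₂ q) (inj₁ (δ , _))  = ⊥-elim (¬degenerate (proj₁ δ) q)
    completion-unique (inj₂ q) (inj₂ q′)       = degenerate-unique q q′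

  skein : Skein (Fin n)
  skein = skeinFromRelation completes-symmetric completion completion-unique
    (λ x y → inj₂ (inj₁ (refl , refl)))

  block⇔op : ∀ {a b c d} → Distinct₄ a b c d → Block 𝒮 (quad a b c d) ⇔ op skein a b c ≡ d
  block⇔op {a} {b} {c} δ = mk⇔
    (λ blk → completion-unique (proj₂ (completion a b c)) (inj₁ (δ , blk)))
    λ { refl → [ proj₂ , (λ q → ⊥-elim (¬degenerate (proj₁ δ) q)) ]′ (proj₂ (completion a b c)) }

-- Uniform lists of labels, and perpendicular arrays

count-⊎ : {A : Set ℓ₁} {P : Pred A ℓ₃} {Q : Pred A ℓ₄} (P? : Decidable P) (Q? : Decidable Q) →
          (∀ x → P x → ¬ Q x) → ∀ xs →
          count (λ x → P? x ⊎-dec Q? x) xs ≡ count P? xs + count Q? xs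
count-⊎ P? Q? disjoint [] = refl
count-⊎ P? Q? disjoint (x ∷ xs) with P? x | Q? x
... | yes px | yes qx = ⊥-elim (disjoint x px qx)
... | yes _  | no _   = cong suc (count-⊎ P? Q? disjoint xs)
... | no _   | yes _  = trans (cong suc (count-⊎ P? Q? disjoint xs)) (sym (+-suc _ _))
... | no _   | no _   = count-⊎ P? Q? disjoint xs

count-× : {A : Set ℓ₁} {P : Pred A ℓ₃} {Q : Pred A ℓ₄} (P? : Decidable P) (Q? : Decidable Q) → ∀ xs →
          count (λ x → P? x ×-dec Q? x) xs ≡ count Q? (filter P? xs)
count-× P? Q? [] = refl
count-× P? Q? (x ∷ xs) with P? x
... | no _ = count-× P? Q? xs
... | yes _ with does (Q? x)
...   | false = count-× P? Q? xs
...   | true  = cong suc (count-× P? Q? xs)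

sum-const : ∀ n {k} {g : Fin n → ℕ} → (∀ i → g i ≡ k) → sum g ≡ n * k
sum-const zero    e = refl
sum-const (suc n) e = cong₂ _+_ (e zero) (sum-const n (e ∘ suc))

sum-except : ∀ {n k u} {g : Fin (suc n) → ℕ} i → g i ≡ u → (∀ j → j ≢ i → g j ≡ k) → sum g ≡ u + n * k
sum-except {n} {g = g} i e e′ = trans (sum-remove {i = i} g)
  (cong₂ _+_ e (sum-const n (λ j → e′ (punchIn i j) (punchInᵢ≢i i j))))

-- Every entry of the list is counted in exactly one fibre.
sum-fibres : ∀ {A : Set ℓ₁} {n} (f : A → Fin (suc n)) xs → sum (λ v → count (λ x → f x ≟ᶠ v) xs) ≡ length xs
sum-fibres {n = n} f [] = trans (sum-const (suc n) (λ _ → refl)) (*-zeroʳ n)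
sum-fibres {n = n} f (x ∷ xs) = begin
  sum (λ v → count (λ y → f y ≟ᶠ v) (x ∷ xs))
    ≡⟨ sum-cong-≗ (λ v → head v) ⟩
  sum (λ v → count (λ y → f y ≟ᶠ v) (x ∷ []) + count (λ y → f y ≟ᶠ v) xs)
    ≡⟨ ∑-distrib-+ (λ v → count (λ y → f y ≟ᶠ v) (x ∷ [])) (λ v → count (λ y → f y ≟ᶠ v) xs) ⟩
  sum (λ v → count (λ y → f y ≟ᶠ v) (x ∷ [])) + sum (λ v → count (λ y → f y ≟ᶠ v) xs)
    ≡⟨ cong₂ _+_ (sum-except (f x) (one (f x) refl) zeros) (sum-fibres f xs) ⟩
  (1 + n * 0) + length xs
    ≡⟨ cong (λ z → suc z + length xs) (*-zeroʳ n) ⟩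
  suc (length xs) ∎
  where
  open ≡-Reasoning
  head : ∀ v → count (λ y → f y ≟ᶠ v) (x ∷ xs) ≡ count (λ y → f y ≟ᶠ v) (x ∷ []) + count (λ y → f y ≟ᶠ v) xs
  head v with does (f x ≟ᶠ v)
  ... | false = refl
  ... | true  = refl
  one : ∀ v → f x ≡ v → count (λ y → f y ≟ᶠ v) (x ∷ []) ≡ 1
  one v e rewrite dec-true (f x ≟ᶠ v) e = refl
  zeros : ∀ v → v ≢ f x → count (λ y → f y ≟ᶠ v) (x ∷ []) ≡ 0
  zeros v e rewrite dec-false (f x ≟ᶠ v) (e ∘ sym) = refl

count-allFin : ∀ {n} (v : Fin n) → count (_≟ᶠ v) (allFin n) ≡ 1
count-allFin {suc n} zero = cong suc (trans (cong (count {A = Fin (suc n)} (_≟ᶠ zero)) (sym (map-tabulate id suc)))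
  (trans (count-map {A = Fin (suc n)} (_≟ᶠ zero) suc (allFin n)) (count-none _ (λ _ ()) (allFin n))))
count-allFin {suc n} (suc v) = trans (cong (count (_≟ᶠ suc v)) (sym (map-tabulate id suc)))
  (trans (count-map (_≟ᶠ suc v) suc (allFin n))
  (trans (count-cong _ (_≟ᶠ v) (λ _ → mk⇔ sucᶠ-injective (cong suc)) (allFin n)) (count-allFin v)))

cycle : ∀ n → ℕ → List (Fin n)
cycle n zero    = []
cycle n (suc m) = allFin n ++ cycle n m

length-cycle : ∀ n m → length (cycle n m) ≡ m * n
length-cycle n zero    = refl
length-cycle n (suc m) = trans (length-++ (allFin n)) (cong₂ _+_ (length-tabulate id) (length-cycle n m))

count-cycle : ∀ {n} m (v : Fin n) → count (_≟ᶠ v) (cycle n m) ≡ m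
count-cycle zero v = refl
count-cycle {n} (suc m) v = trans (count-++ (_≟ᶠ v) (allFin n) _) (cong₂ _+_ (count-allFin v) (count-cycle m v))

2*[1+n]C2 : ∀ n → 2 * (suc n C 2) ≡ suc n * n
2*[1+n]C2 zero = refl
2*[1+n]C2 (suc n) = begin
  2 * (suc (suc n) C 2)              ≡⟨ cong (2 *_) (nCk+nC[k+1]≡[n+1]C[k+1] (suc n) 1) ⟨
  2 * ((suc n C 1) + (suc n C 2))    ≡⟨ cong (λ z → 2 * (z + (suc n C 2))) (nC1≡n (suc n)) ⟩
  2 * (suc n + (suc n C 2))          ≡⟨ *-distribˡ-+ 2 (suc n) _ ⟩
  2 * suc n + 2 * (suc n C 2)        ≡⟨ cong (2 * suc n +_) (2*[1+n]C2 n) ⟩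
  2 * suc n + suc n * n              ≡⟨ lemma n ⟩
  suc (suc n) * suc n                ∎
  where
  open ≡-Reasoning
  lemma : ∀ n → 2 * suc n + suc n * n ≡ suc (suc n) * suc n
  lemma = solve-∀

-- The rows of a perpendicular array as permutations.

-- A missed value could be punched out of the codomain, leaving an injection into a smaller set.
injective⇒surjective : ∀ {n} (f : Fin n → Fin n) → Injective _≡_ _≡_ f → ∀ y → ∃[ x ] f x ≡ y
injective⇒surjective {suc n} f f-inj y with any? (λ x → f x ≟ᶠ y)
... | yes found = found
... | no avoids = ⊥-elim (1+n≰n (injective⇒≤ {f = λ x → punchOut (avoid x)}
                           (λ {i} {j} e → f-inj (punchOut-injective (avoid i) (avoid j) e))))
  where
  avoid : ∀ x → y ≢ f x
  avoid x e = avoids (x , sym e)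

bijection : ∀ {n} (f : Fin n → Fin n) → Injective _≡_ _≡_ f → Bijection (Fin n)
bijection {n} f f-inj = record { dir = both ; dir-inv = both-inv }
  where
  both : Bool → Fin n → Fin n
  both false = f
  both true y = proj₁ (injective⇒surjective f f-inj y)
  both-inv : ∀ ε x → both (not ε) (both ε x) ≡ x
  both-inv false x = f-inj (proj₂ (injective⇒surjective f f-inj (f x)))
  both-inv true  y = proj₂ (injective⇒surjective f f-inj y)

module _ {m n : ℕ} (f : Fin m → Fin n) (X : Subset m) where

  private
    hit? : ∀ y → Dec (∃[ x ] x ∈ˢ X × f x ≡ y)
    hit? y = any? λ x → (x ∈? X) ×-dec (f x ≟ᶠ y)

  ∈-image⁺ : ∀ {x} → x ∈ˢ X → f x ∈ˢ image f X
  ∈-image⁺ {x} x∈ = lookup⇒[]= (f x) (image f X)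
    (trans (lookup∘tabulate _ (f x)) (dec-true (hit? (f x)) (x , x∈ , refl)))

  ∈-image⁻ : ∀ {y} → y ∈ˢ image f X → ∃[ x ] x ∈ˢ X × f x ≡ y
  ∈-image⁻ {y} y∈ with hit? y | trans (sym (lookup∘tabulate (does ∘ hit?) y)) ([]=⇒lookup y∈)
  ... | yes found | _ = found

pair : ∀ {n} → Fin n → Fin n → Subset n
pair x y = set (x ∷ y ∷ [])

∈-pair⁻ : ∀ {n} {x y z : Fin n} → z ∈ˢ pair x y → z ≡ x ⊎ z ≡ y
∈-pair⁻ {x = x} {y} z∈ with ∈-set⁻ (x ∷ y ∷ []) z∈
... | here e = inj₁ e
... | there (here e) = inj₂ e

∣pair∣ : ∀ {n} {x y : Fin n} → x ≢ y → ∣ pair x y ∣ ≡ 2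
∣pair∣ x≢y = ∣set∣ ((x≢y ∷ []) ∷ [] ∷ [])

pair-comm : ∀ {n} (x y : Fin n) → pair x y ≡ pair y x
pair-comm x y = set-swap x y []

image-pair : ∀ {m n} (f : Fin m → Fin n) x y → image f (pair x y) ≡ pair (f x) (f y)
image-pair f x y = ⊆-antisym to from
  where
  to : image f (pair x y) ⊆ pair (f x) (f y)
  to z∈ with ∈-image⁻ f (pair x y) z∈
  ... | u , u∈ , refl with ∈-pair⁻ u∈
  ...   | inj₁ refl = ∈-set⁺ (f x ∷ f y ∷ []) (here refl)
  ...   | inj₂ refl = ∈-set⁺ (f x ∷ f y ∷ []) (there (here refl))
  from : pair (f x) (f y) ⊆ image f (pair x y)
  from z∈ with ∈-pair⁻ z∈
  ... | inj₁ refl = ∈-image⁺ f (pair x y) (∈-set⁺ (x ∷ y ∷ []) (here refl))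
  ... | inj₂ refl = ∈-image⁺ f (pair x y) (∈-set⁺ (x ∷ y ∷ []) (there (here refl)))

pair-injective : ∀ {n} {x y u v : Fin n} → x ≢ y → pair x y ≡ pair u v → (x ≡ u × y ≡ v) ⊎ (x ≡ v × y ≡ u)
pair-injective {x = x} {y} {u} {v} x≢y e
  with ∈-pair⁻ (subst (x ∈ˢ_) e (∈-set⁺ (x ∷ y ∷ []) (here refl)))
     | ∈-pair⁻ (subst (y ∈ˢ_) e (∈-set⁺ (x ∷ y ∷ []) (there (here refl))))
... | inj₁ refl | inj₁ refl = ⊥-elim (x≢y refl)
... | inj₁ x≡u  | inj₂ y≡v  = inj₁ (x≡u , y≡v)
... | inj₂ x≡v  | inj₁ y≡u  = inj₂ (x≡v , y≡u)
... | inj₂ refl | inj₂ refl = ⊥-elim (x≢y refl)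

module Perpendicular {γ r : ℕ} (PA : PerpendicularArray γ 2 (3 + r) (3 + r)) where

  open PerpendicularArray PA

  private
    N = 3 + r

    rows : List (Fin (γ * (N C 2)))
    rows = allFin (γ * (N C 2))

    -- There are as many columns as symbols, so the distinct entries of a row make it a permutation.
    row : Fin (γ * (N C 2)) → Bijection (Fin N)
    row i = bijection (entry i) (distinct i)

  permutations : List (Bijection (Fin N))
  permutations = map row rows

  length-permutations : length permutations ≡ γ * (N C 2)
  length-permutations = trans (length-map row rows) (length-tabulate id)

  private
    Maps : Fin N → Fin N → Fin N → Fin N → Bijection (Fin N) → Set
    Maps a b c d π = (dir π false a ≡ c × dir π false b ≡ d) ⊎ (dir π false a ≡ d × dir π false b ≡ c)

  maps? : ∀ ε a b c d (π : Bijection (Fin N)) →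
          Dec ((dir π ε a ≡ c × dir π ε b ≡ d) ⊎ (dir π ε a ≡ d × dir π ε b ≡ c))
  maps? ε a b c d π = ((dir π ε a ≟ᶠ c) ×-dec (dir π ε b ≟ᶠ d)) ⊎-dec
                      ((dir π ε a ≟ᶠ d) ×-dec (dir π ε b ≟ᶠ c))

  dir-swap : ∀ (π : Bijection (Fin N)) ε {a c} → dir π ε a ≡ c → dir π (not ε) c ≡ a
  dir-swap π ε refl = dir-inv π ε _

  private
    perpendicular-false : ∀ {a b c d} → a ≢ b → c ≢ d → count (maps? false a b c d) permutations ≡ γ
    perpendicular-false {a} {b} {c} {d} a≢b c≢d = trans (count-map (maps? false a b c d) row rows)
      (trans (count-cong _ (λ i → image (entry i) (pair a b) ≟ˢ pair c d)
               (λ i → mk⇔ (to i) (pair-injective (a≢b ∘ distinct i) ∘ trans (sym (image-pair (entry i) a b)))) rows)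
             (balanced (pair a b) (pair c d) (∣pair∣ a≢b) (∣pair∣ c≢d)))
      where
      to : ∀ i → Maps a b c d (row i) → image (entry i) (pair a b) ≡ pair c d
      to i (inj₁ (refl , refl)) = image-pair (entry i) a b
      to i (inj₂ (refl , refl)) = trans (image-pair (entry i) a b) (pair-comm (entry i a) (entry i b))

  -- The inverse takes one pair to another exactly when the permutation takes the second pair to the
  -- first, so the case `true` is the case `false` with the pairs exchanged.
  perpendicular : ∀ ε {a b c d} → a ≢ b → c ≢ d → count (maps? ε a b c d) permutations ≡ γ
  perpendicular false a≢b c≢d = perpendicular-false a≢b c≢d
  perpendicular true {a} {b} {c} {d} a≢b c≢d = trans
    (count-cong _ (maps? false c d a b) (λ π → mk⇔
      (λ { (inj₁ (e , e′)) → inj₁ (dir-swap π true e , dir-swap π true e′)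
         ; (inj₂ (e , e′)) → inj₂ (dir-swap π true e′ , dir-swap π true e) })
      (λ { (inj₁ (e , e′)) → inj₁ (dir-swap π false e , dir-swap π false e′)
         ; (inj₂ (e , e′)) → inj₂ (dir-swap π false e′ , dir-swap π false e) })) permutations)
    (perpendicular-false c≢d a≢b)

  private
    hits : Fin N → Fin N → ℕ
    hits a c = count (λ π → dir π false a ≟ᶠ c) permutations

    dir-injective : ∀ (π : Bijection (Fin N)) {a b} → dir π false a ≡ dir π false b → a ≡ b
    dir-injective π e = trans (sym (dir-inv π false _)) (trans (cong (dir π true) e) (dir-inv π false _))

    -- Sum over all d the number of permutations taking {a , b} to {c , d}.
    two-columns : ∀ {a b} c → a ≢ b → hits a c + hits b c ≡ (N ∸ 1) * γ
    two-columns {a} {b} c a≢b = begin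
      hits a c + hits b c
        ≡⟨ cong₂ _+_ (fibres a b) (fibres b a) ⟩
      sum (λ d → count (both a b d) permutations) + sum (λ d → count (both b a d) permutations)
        ≡⟨ ∑-distrib-+ (λ d → count (both a b d) permutations) (λ d → count (both b a d) permutations) ⟨
      sum (λ d → count (both a b d) permutations + count (both b a d) permutations)
        ≡⟨ sum-cong-≗ (λ d → sym (trans (count-cong (maps? false a b c d) (λ π → both a b d π ⊎-dec both b a d π)
               (λ _ → mk⇔ (Sum.map₂ swap) (Sum.map₂ swap)) permutations)
             (count-⊎ (both a b d) (both b a d)
               (λ π (e , _) (e′ , _) → a≢b (dir-injective π (trans e (sym e′)))) permutations))) ⟩
      sum (λ d → count (maps? false a b c d) permutations)
        ≡⟨ sum-except c (count-none (maps? false a b c c) absurd permutations)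
             (λ d d≢c → perpendicular-false a≢b (d≢c ∘ sym)) ⟩
      (N ∸ 1) * γ ∎
      where
      open ≡-Reasoning
      both : ∀ a b d (π : Bijection (Fin N)) → Dec (dir π false a ≡ c × dir π false b ≡ d)
      both a b d π = (dir π false a ≟ᶠ c) ×-dec (dir π false b ≟ᶠ d)
      fibres : ∀ a b → hits a c ≡ sum (λ d → count (both a b d) permutations)
      fibres a b = sym (trans
        (sum-cong-≗ (λ d → count-× (λ π → dir π false a ≟ᶠ c) (λ π → dir π false b ≟ᶠ d) permutations))
        (sum-fibres (λ π → dir π false b) (filter (λ π → dir π false a ≟ᶠ c) permutations)))
      absurd : ∀ π → ¬ Maps a b c c π
      absurd π (inj₁ (e , e′)) = a≢b (dir-injective π (trans e (sym e′)))
      absurd π (inj₂ (e , e′)) = a≢b (dir-injective π (trans e (sym e′)))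

  module _ {μ : ℕ} (2μ : 2 * μ ≡ (N ∸ 1) * γ) where

    private
      -- Any two columns contain `c` the same number of times in total. Comparing two pairs that
      -- share the column `b` shows that columns `a` and `b′` agree, and the pair of these two then
      -- gives the value.
      three-columns : ∀ {a b b′} c → a ≢ b → a ≢ b′ → b ≢ b′ → hits a c ≡ μ
      three-columns {a} {b} {b′} c a≢b a≢b′ b≢b′ = *-cancelˡ-≡ (hits a c) μ 2 (begin
        2 * hits a c          ≡⟨ cong (hits a c +_) (+-identityʳ (hits a c)) ⟩
        hits a c + hits a c   ≡⟨ cong (hits a c +_) hits-a≡hits-b′ ⟩
        hits a c + hits b′ c  ≡⟨ two-columns c a≢b′ ⟩
        (N ∸ 1) * γ           ≡⟨ 2μ ⟨
        2 * μ                 ∎)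
        where
        open ≡-Reasoning
        hits-a≡hits-b′ : hits a c ≡ hits b′ c
        hits-a≡hits-b′ = +-cancelʳ-≡ (hits b c) (hits a c) (hits b′ c)
          (trans (two-columns c a≢b) (sym (two-columns c (b≢b′ ∘ sym))))

      uniform-false : ∀ a c → hits a c ≡ μ
      uniform-false 0F            c = three-columns {b = 1F} {2F} c (λ ()) (λ ()) (λ ())
      uniform-false 1F            c = three-columns {b = 0F} {2F} c (λ ()) (λ ()) (λ ())
      uniform-false (suc (suc _)) c = three-columns {b = 0F} {1F} c (λ ()) (λ ()) (λ ())

    uniformly-distributed : ∀ ε a c → count (λ π → dir π ε a ≟ᶠ c) permutations ≡ μ
    uniformly-distributed false a c = uniform-false a c
    uniformly-distributed true  a c = trans
      (count-cong _ (λ π → dir π false c ≟ᶠ a) (λ π → mk⇔ (dir-swap π true) (dir-swap π false)) permutations)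
      (uniform-false c a)

-- The lists of indices, and the assembly of the large set.

-- Sort the systems by their completion of the triple 0, 1, 2: it is none of these points, and each
-- of the `suc r` others occurs `μ` times.
length-from-uniform : ∀ {r μ} (Ss : List (Skein (Fin (4 + r)))) →
  (∀ {a b c d} → Distinct₄ a b c d → number _≟ᶠ_ Ss a b c d ≡ μ) → length Ss ≡ suc r * μ
length-from-uniform {r} {μ} Ss uniform = begin
  length Ss                                 ≡⟨ sum-fibres (λ S → op S 0F 1F 2F) Ss ⟨
  fibre 0F + (fibre 1F + (fibre 2F + _))
    ≡⟨ cong₂ _+_ (old 0F (λ S → proj₁ (proj₂ (d S)) ∘ sym)) (cong₂ _+_ (old 1F (λ S → proj₂ (proj₂ (d S)) ∘ sym))
         (cong₂ _+_ (old 2F (λ S → proj₂ (proj₂ (d′ S)) ∘ sym ∘ trans (swap₂₃ S 0F 2F 1F))) (sum-const (suc r) new))) ⟩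
  suc r * μ                                 ∎
  where
  open ≡-Reasoning
  fibre : Fin (4 + r) → ℕ
  fibre v = count (λ S → op S 0F 1F 2F ≟ᶠ v) Ss
  old : ∀ v → (∀ S → op S 0F 1F 2F ≢ v) → fibre v ≡ 0
  old v e = count-none _ e Ss
  d : ∀ S → Distinct₃ 0F 1F (op S 0F 1F 2F)
  d S = distinct-op S ((λ ()) , (λ ()) , (λ ()))
  d′ : ∀ S → Distinct₃ 0F 2F (op S 0F 2F 1F)
  d′ S = distinct-op S ((λ ()) , (λ ()) , (λ ()))
  new : ∀ v → fibre (suc (suc (suc v))) ≡ μ
  new v = uniform (((λ ()) , (λ ()) , (λ ())) , ((λ ()) , (λ ()) , (λ ())))

upperLabels : ∀ r → ℕ → List (Fin (4 + r))
upperLabels r μ = map (λ v → suc (suc (suc v))) (cycle (suc r) μ)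

upperLabels-uniform : ∀ {r} μ (v : Fin (4 + r)) → count (_≟ᶠ v) (upperLabels r μ) +
  (select (does (v ≟ᶠ 0F)) μ + (select (does (v ≟ᶠ 1F)) μ + select (does (v ≟ᶠ 2F)) μ)) ≡ μ
upperLabels-uniform {r} μ = λ where
    0F → cong₂ _+_ (none 0F (λ _ ())) (+-identityʳ μ)
    1F → cong₂ _+_ (none 1F (λ _ ())) (+-identityʳ μ)
    2F → cong (_+ μ) (none 2F (λ _ ()))
    (suc (suc (suc v))) → trans (+-identityʳ _)
      (trans (count-map (_≟ᶠ suc (suc (suc v))) _ (cycle (suc r) μ))
      (trans (count-cong _ (_≟ᶠ v)
               (λ _ → mk⇔ (sucᶠ-injective ∘ sucᶠ-injective ∘ sucᶠ-injective) (cong (λ v → suc (suc (suc v)))))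
               (cycle (suc r) μ))
             (count-cycle μ v)))
  where
  none : ∀ v → (∀ w → suc (suc (suc w)) ≢ v) → count (_≟ᶠ v) (upperLabels r μ) ≡ 0
  none v e = trans (count-map (_≟ᶠ v) _ (cycle (suc r) μ)) (count-none _ e (cycle (suc r) μ))

fromSkeins : ∀ {n μ} → 4 ≤ n → (Ss : List (Skein (Fin n))) →
  (∀ {x y z w} → Distinct₄ x y z w → number _≟ᶠ_ Ss x y z w ≡ μ) → LargeSet 3 4 n μ
fromSkeins {n} {μ} 4≤n Ss number≡μ = record
  { k≤n     = 4≤n
  ; systems = map FromSkein.system Ss
  ; uniform = uniform
  }
  where
  uniform : ∀ K → ∣ K ∣ ≡ 4 → multiplicity (map FromSkein.system Ss) K ≡ μ
  uniform K e with extend [] 4 {K} [] (λ ()) e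
  ... | x ∷ y ∷ z ∷ w ∷ [] , _ , u , refl = trans
    (count-map (λ 𝒮 → block? 𝒮 (quad x y z w)) FromSkein.system Ss)
    (trans (count-cong _ (λ S → op S x y z ≟ᶠ w) (λ S → FromSkein.block⇔op S (distinct₄ u)) Ss)
           (number≡μ (distinct₄ u)))

toSkeins-uniform : ∀ {n μ} (𝓛 : LargeSet 3 4 n μ) → ∀ {a b c d} → Distinct₄ a b c d →
  number _≟ᶠ_ (map ToSkein.skein (LargeSet.systems 𝓛)) a b c d ≡ μ
toSkeins-uniform 𝓛 {a} {b} {c} {d} δ = trans
  (count-map (λ S → op S a b c ≟ᶠ d) ToSkein.skein systems)
  (trans (sym (count-cong (λ 𝒮 → block? 𝒮 (quad a b c d)) _ (λ 𝒮 → ToSkein.block⇔op 𝒮 δ) systems))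
         (uniform (quad a b c d) (∣set∣ (unique₄ δ))))
  where open LargeSet 𝓛

-- Numbering of the points of the four groups.

groupCode : Group → Fin 4
groupCode (false , false) = 0F
groupCode (false , true)  = 1F
groupCode (true  , false) = 2F
groupCode (true  , true)  = 3F

groupOf : Fin 4 → Group
groupOf 0F = false , false
groupOf 1F = false , true
groupOf 2F = true , false
groupOf 3F = true , true

groupOf-code : ∀ i → groupOf (groupCode i) ≡ i
groupOf-code (false , false) = refl
groupOf-code (false , true)  = refl
groupOf-code (true  , false) = refl
groupOf-code (true  , true)  = refl

groupCode-of : ∀ i → groupCode (groupOf i) ≡ i
groupCode-of 0F = refl
groupCode-of 1F = refl
groupCode-of 2F = refl
groupCode-of 3F = refl

module Code (n : ℕ) where

  encode : Bool × (Bool × Fin n) → Fin (4 * n)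
  encode (h , (ε , a)) = combine (groupCode (h , ε)) a

  private
    place : Fin 4 × Fin n → Bool × (Bool × Fin n)
    place (i , a) = proj₁ (groupOf i) , (proj₂ (groupOf i) , a)

  decode : Fin (4 * n) → Bool × (Bool × Fin n)
  decode x = place (remQuot {4} n x)

  decode-encode : ∀ x → decode (encode x) ≡ x
  decode-encode (h , (ε , a)) = trans (cong place (remQuot-combine (groupCode (h , ε)) a))
    (cong (λ i → proj₁ i , (proj₂ i , a)) (groupOf-code (h , ε)))

  encode-decode : ∀ x → encode (decode x) ≡ x
  encode-decode x = trans
    (cong (λ i → combine i (proj₂ (remQuot {4} n x))) (groupCode-of (proj₁ (remQuot {4} n x))))
    (combine-remQuot {4} n x)

  decode-injective : ∀ {x y} → decode x ≡ decode y → x ≡ y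
  decode-injective {x} {y} e = trans (sym (encode-decode x)) (trans (cong encode e) (encode-decode y))

-- Put n = `4 + r`. There are (n - 3)`μ` systems of sort A and n`μ` of sort B for each of the three
-- splittings, in all the (4n - 3)`μ` systems of a large set on 4n points.
quadruple : ∀ r γ μ → 2 * μ ≡ (3 + r) * γ → Skein (Fin (4 + r)) → LargeSet 3 4 (4 + r) μ →
            PerpendicularArray γ 2 (4 + r) (4 + r) → LargeSet 3 4 (4 * (4 + r)) μ
quadruple r γ μ 2μ S₀ 𝓛 PA = fromSkeins (m≤m*n 4 (4 + r)) (map recode family)
  (λ {x} {y} {z} {w} ((p , q , s) , (t , u , v)) → trans
    (number-map _≟ᶠ_ recode (λ S → op S (decode x) (decode y) (decode z) ≟ᵖ decode w)
      (λ S → mk⇔ (λ e → trans (sym (decode-encode _)) (cong decode e))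
                 (λ e → trans (cong encode e) (encode-decode w))) family)
    (family-uniform ((p ∘ decode-injective , q ∘ decode-injective , s ∘ decode-injective) ,
                     (t ∘ decode-injective , u ∘ decode-injective , v ∘ decode-injective))))
  where
  open Code (4 + r)

  recode : Skein (Bool × (Bool × Fin (4 + r))) → Skein (Fin (4 * (4 + r)))
  recode = conjugate decode encode encode-decode decode-encode

  M : ℕ
  -- The subtraction is exact: by `2μ` and `3 + r` being at least 2, `γ` is at most `μ`.
  M = μ ∸ γ

  Ss = map ToSkein.skein (LargeSet.systems 𝓛)
  ts = upperLabels r μ
  us = cycle (3 + r) M
  ss = cycle (4 + r) μ

  module PA = Perpendicular PA

  open Family S₀ Ss ts us PA.permutations ss μ γ M using (_≟ᵖ_; module Uniform)

  γ≤μ : γ ≤ μ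
  γ≤μ = *-cancelˡ-≤ 2 (≤-trans (*-monoˡ-≤ γ {2} {3 + r} (s≤s (s≤s z≤n))) (≤-reflexive (sym 2μ)))

  M+γ≡μ : M + γ ≡ μ
  M+γ≡μ = m∸n+n≡m γ≤μ

  2M : 2 * M ≡ (1 + r) * γ
  2M = +-cancelʳ-≡ (2 * γ) (2 * M) ((1 + r) * γ) (begin
    2 * M + 2 * γ          ≡⟨ *-distribˡ-+ 2 M γ ⟨
    2 * (M + γ)            ≡⟨ cong (2 *_) M+γ≡μ ⟩
    2 * μ                  ≡⟨ 2μ ⟩
    (3 + r) * γ            ≡⟨ lemma r γ ⟩
    (1 + r) * γ + 2 * γ    ∎)
    where
    open ≡-Reasoning
    lemma : ∀ r γ → (3 + r) * γ ≡ (1 + r) * γ + 2 * γ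
    lemma = solve-∀

  length-Ss : length Ss ≡ (1 + r) * μ
  length-Ss = length-from-uniform Ss (toSkeins-uniform 𝓛)

  length-ts : length ts ≡ μ * (1 + r)
  length-ts = trans (length-map _ (cycle (suc r) μ)) (length-cycle (suc r) μ)

  -- Follows from `M+γ≡μ` and `2M`. It lets each of the `3 + r` reflections be used `M` times over
  -- the systems of sort A.
  μ-M : μ * (1 + r) ≡ M * (3 + r)
  μ-M = begin
    μ * (1 + r)                ≡⟨ cong (_* (1 + r)) M+γ≡μ ⟨
    (M + γ) * (1 + r)          ≡⟨ *-distribʳ-+ (1 + r) M γ ⟩
    M * (1 + r) + γ * (1 + r)  ≡⟨ cong (M * (1 + r) +_) (trans (*-comm γ (1 + r)) (sym 2M)) ⟩
    M * (1 + r) + 2 * M        ≡⟨ lemma r M ⟩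
    M * (3 + r)                ∎
    where
    open ≡-Reasoning
    lemma : ∀ r M → M * (1 + r) + 2 * M ≡ M * (3 + r)
    lemma = solve-∀

  -- Counts the rows of the array in two ways, so that each of the `4 + r` values of `s` is paired
  -- with `μ` rows.
  γ-C : γ * ((4 + r) C 2) ≡ μ * (4 + r)
  γ-C = *-cancelˡ-≡ _ _ 2 (begin
    2 * (γ * ((4 + r) C 2))    ≡⟨ x*[y*z] 2 γ _ ⟩
    γ * (2 * ((4 + r) C 2))    ≡⟨ cong (γ *_) (2*[1+n]C2 (3 + r)) ⟩
    γ * ((4 + r) * (3 + r))    ≡⟨ lemma r γ ⟩
    (3 + r) * γ * (4 + r)      ≡⟨ cong (_* (4 + r)) 2μ ⟨
    2 * μ * (4 + r)            ≡⟨ *-assoc 2 μ (4 + r) ⟩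
    2 * (μ * (4 + r))          ∎)
    where
    open ≡-Reasoning
    x*[y*z] : ∀ x y z → x * (y * z) ≡ y * (x * z)
    x*[y*z] = solve-∀
    lemma : ∀ r γ → γ * ((4 + r) * (3 + r)) ≡ (3 + r) * γ * (4 + r)
    lemma = solve-∀

  open Uniform
    (trans length-Ss (trans (*-comm (1 + r) μ) (sym length-ts)))
    (trans length-ts (trans μ-M (sym (length-cycle (3 + r) M))))
    (trans PA.length-permutations (trans γ-C (sym (length-cycle (4 + r) μ))))
    (toSkeins-uniform 𝓛)
    (count-cycle M)
    M+γ≡μ
    (upperLabels-uniform μ)
    (count-cycle μ)
    (PA.uniformly-distributed 2μ)
    PA.perpendicular
    using (family; family-uniform)

theorem29 : (n γ μ : ℕ) → 1 ≤ n → 1 ≤ γ →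
            2 * μ ≡ (n ∸ 1) * γ →
            LargeSet 3 4 n μ →
            PerpendicularArray γ 2 n n →
            LargeSet 3 4 (4 * n) μ
theorem29 n γ μ _ 1≤γ 2μ 𝓛 PA with LargeSet.k≤n 𝓛
-- The bound `k≤n` makes `n` equal to `4 + r`.
... | s≤s (s≤s (s≤s (s≤s {n = r} _))) with LargeSet.systems 𝓛 in eq
-- Any system of the given large set can supply the labels; the first is taken.
...   | 𝒮 ∷ _ = quadruple r γ μ 2μ (ToSkein.skein 𝒮) 𝓛 PA
-- An empty large set would force `μ` to be 0, whereas `2μ` and `1≤γ` make it positive.
...   | [] = ⊥-elim (1+n≰n (begin
  1              ≤⟨ 1≤γ ⟩
  γ              ≤⟨ m≤n*m γ (3 + r) ⟩
  (3 + r) * γ    ≡⟨ 2μ ⟨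
  2 * μ          ≡⟨ cong (2 *_) (subst (λ 𝒮s → number _≟ᶠ_ (map ToSkein.skein 𝒮s) 0F 1F 2F 3F ≡ μ) eq
                     (toSkeins-uniform 𝓛 (((λ ()) , (λ ()) , (λ ())) , ((λ ()) , (λ ()) , (λ ()))))) ⟨
  0              ∎))
  where open ≤-Reasoning
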